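{- For any distinct $\gamma_1, \gamma_2 \in (0,\tfrac{1}{2}]$ and any $0<\delta<1$, there exists a real sequence $(y_n)_{n\in\mathbb{N}}$ that has weak $\gamma_1$-PPC (with parameter $\delta$) but does not have weak $\gamma_2$-PPC (with parameter $\delta$).
   Context: $\|\cdot\|$ denotes the distance to the nearest integer, and $\sharp$ denotes cardinality; pairs $(m,n)$ below are ordered pairs. For $\gamma\in(0,1)$ and $0<\delta<1$, a sequence $(y_n)_{n\in\mathbb{N}}$ of real numbers has weak $\gamma$-PPC (with parameter $\delta$) if for every $s>0$, $$\lim_{N\to\infty}\frac{1}{N^{2-\delta}}\,\sharp \left\{ 1 \leq m \neq n \leq N : \|y_m - y_n-\gamma\| \leq \frac{s}{N^{\delta}} \right\} =2s.$$ -}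

module Defs where

open import Level using (0ℓ)
open import Algebra.Bundles using (CommutativeRing)
open import Algebra.Structures using (IsCommutativeRing)
import Algebra.Construct.NaturalChoice.Max as NaturalMax
import Algebra.Properties.CommutativeSemiring.Exp as Exp
import Algebra.Properties.Ring as RingProperties
import Algebra.Properties.Semiring.Mult as Mult
open import Data.Empty using (⊥-elim)
open import Data.Integer.Base using (ℤ; +_; -[1+_])
open import Data.List.Base using (List; applyUpTo; cartesianProduct; filter; length)
open import Data.Nat.Base as ℕ using (ℕ; zero; suc; NonZero; z≤n; s≤s)
import Data.Nat.Properties as ℕ
open import Data.Product.Base using (∃; ∃-syntax; _×_; _,_; proj₁; proj₂)
open import Data.Sum.Base using (inj₁; inj₂)
open import Relation.Binary.Bundles using (DecTotalOrder)
import Relation.Binary.Construct.NonStrictToStrict as ToStrict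
open import Relation.Binary.PropositionalEquality.Core using (_≢_)
import Relation.Binary.Reasoning.PartialOrder as POReasoning
open import Relation.Binary.Structures using (IsDecTotalOrder)
open import Relation.Nullary.Decidable using (yes; no; ¬?; _×-dec_)
open import Relation.Nullary.Negation using (¬_; contradiction)
open import Relation.Unary using (Pred; Decidable)

module Suprema {A : Set} (_≈_ _≤_ : A → A → Set) where

  open ToStrict _≈_ _≤_ public using (_<_)

  IsUpperBound IsLowerBound IsSupremum : Pred A 0ℓ → A → Set
  IsUpperBound P u = ∀ {x} → P x → x ≤ u
  IsLowerBound P l = ∀ {x} → P x → l ≤ x
  IsSupremum P s =
    IsUpperBound P s × (∀ {u} → u < s → ∃[ x ] (P x × u < x))

-- The standard library has no real numbers.  ℝ is the Dedekind-complete
-- ordered field, which is unique up to unique isomorphism, and is used here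
-- through these axioms.
--
-- The axioms are the classical ones: the order is total and decidable, and
-- every inhabited bounded set has a supremum, which is approximated from below
-- by elements of the set.  Under excluded middle the last clause says exactly
-- that the supremum is the least upper bound, and models exist (for instance,
-- the Cauchy reals); conversely, a model yields excluded middle for Set.
record CompleteOrderedField : Set₁ where
  infix  8 _⁻¹
  infixl 7 _*_ _/_
  infixl 6 _+_
  infix  4 _≈_ _≤_

  field
    Carrier : Set
    _≈_ _≤_ : Carrier → Carrier → Set
    _+_ _*_ : Carrier → Carrier → Carrier
    -_      : Carrier → Carrier
    0# 1#   : Carrier
    -- The value at 0# is left unspecified.
    _⁻¹     : Carrier → Carrier

    isCommutativeRing : IsCommutativeRing _≈_ _+_ _*_ -_ 0# 1#
    isDecTotalOrder   : IsDecTotalOrder _≈_ _≤_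
    0≉1               : ¬ (0# ≈ 1#)
    ⁻¹-cong           : ∀ {x y} → x ≈ y → x ⁻¹ ≈ y ⁻¹
    ⁻¹-inverseʳ       : ∀ {x} → ¬ (x ≈ 0#) → x * x ⁻¹ ≈ 1#
    +-monoˡ-≤         : ∀ z {x y} → x ≤ y → x + z ≤ y + z
    *-nonneg          : ∀ {x y} → 0# ≤ x → 0# ≤ y → 0# ≤ x * y

  open Suprema _≈_ _≤_ public

  field
    complete : (P : Pred Carrier 0ℓ) → ∃ P → ∃ (IsUpperBound P) → ∃ (IsSupremum P)

  _/_ : Carrier → Carrier → Carrier
  x / y = x * y ⁻¹

  commutativeRing : CommutativeRing 0ℓ 0ℓ
  commutativeRing = record { isCommutativeRing = isCommutativeRing }

  decTotalOrder : DecTotalOrder 0ℓ 0ℓ 0ℓ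
  decTotalOrder = record { isDecTotalOrder = isDecTotalOrder }

  open CommutativeRing commutativeRing public
    hiding (Carrier; _≈_; _+_; _*_; -_; 0#; 1#; isCommutativeRing; zero)
  open DecTotalOrder decTotalOrder public
    using (_≤?_; _≟_; total; antisym; totalOrder; poset; ≤-respˡ-≈; ≤-respʳ-≈)
    renaming (refl to ≤-refl; reflexive to ≤-reflexive; trans to ≤-trans)

module RealAnalysis (R : CompleteOrderedField) where

  open CompleteOrderedField R public
  open Exp commutativeSemiring public using (_^_; ^-congˡ; ^-homo-*; ^-assocʳ)
  open Mult semiring using (×-homo-+; ×1-homo-*) renaming (_×_ to _·_)
  open RingProperties ring
    using ( -0#≈0#; -‿involutive; -‿distribˡ-*; -‿distribʳ-*; x[y-z]≈xy-xz; [y-z]x≈yx-zx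
          ; xyx⁻¹≈y; //-rightDividesˡ; //-rightDividesʳ )
    renaming (⁻¹-anti-homo‿- to -‿anti-homo‿-)
  open NaturalMax totalOrder public using (_⊔_)
  private module ≤-R = POReasoning poset

  fromℕ : ℕ → Carrier
  fromℕ n = n · 1#

  fromℤ : ℤ → Carrier
  fromℤ (+ n)    = fromℕ n
  fromℤ -[1+ n ] = - fromℕ (suc n)

  ∣_∣ : Carrier → Carrier
  ∣ x ∣ = x ⊔ (- x)

  ≤⇒0≤- : ∀ {x y} → x ≤ y → 0# ≤ y - x
  ≤⇒0≤- {x} {y} x≤y = ≤-respˡ-≈ (-‿inverseʳ x) (+-monoˡ-≤ (- x) x≤y)

  0≤-⇒≤ : ∀ {x y} → 0# ≤ y - x → x ≤ y
  0≤-⇒≤ {x} {y} h =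
    ≤-respˡ-≈ (+-identityˡ x)
      (≤-respʳ-≈ (//-rightDividesˡ x y) (+-monoˡ-≤ x h))

  neg-mono-≤ : ∀ {x y} → x ≤ y → - y ≤ - x
  neg-mono-≤ {x} {y} x≤y = 0≤-⇒≤
    (≤-respʳ-≈ (trans (+-comm y (- x)) (+-congˡ (sym (-‿involutive y)))) (≤⇒0≤- x≤y))

  +-mono-≤ : ∀ {x y u v} → x ≤ y → u ≤ v → x + u ≤ y + v
  +-mono-≤ {x} {y} {u} {v} x≤y u≤v = begin
    x + u ≤⟨ +-monoˡ-≤ u x≤y ⟩
    y + u ≈⟨ +-comm y u ⟩
    u + y ≤⟨ +-monoˡ-≤ y u≤v ⟩
    v + y ≈⟨ +-comm v y ⟩
    y + v ∎
    where open ≤-R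

  *-monoˡ-≤ : ∀ {z x y} → 0# ≤ z → x ≤ y → z * x ≤ z * y
  *-monoˡ-≤ {z} {x} {y} 0≤z x≤y = 0≤-⇒≤
    (≤-respʳ-≈ (x[y-z]≈xy-xz z y x)
      (*-nonneg 0≤z (≤⇒0≤- x≤y)))

  *-mono-≤ : ∀ {x y u v} → 0# ≤ u → 0# ≤ y → x ≤ y → u ≤ v → x * u ≤ y * v
  *-mono-≤ {x} {y} {u} {v} 0≤u 0≤y x≤y u≤v = begin
    x * u ≈⟨ *-comm x u ⟩
    u * x ≤⟨ *-monoˡ-≤ 0≤u x≤y ⟩
    u * y ≈⟨ *-comm u y ⟩
    y * u ≤⟨ *-monoˡ-≤ 0≤y u≤v ⟩
    y * v ∎
    where open ≤-R

  0≤1 : 0# ≤ 1#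
  0≤1 with total 0# 1#
  ... | inj₁ h = h
  ... | inj₂ h = ≤-respʳ-≈ -1*-1≈1
                   (*-nonneg 0≤-1 0≤-1)
    where
    -1*-1≈1 : - 1# * - 1# ≈ 1#
    -1*-1≈1 = trans (sym (-‿distribˡ-* 1# (- 1#)))
                (trans (-‿cong (*-identityˡ (- 1#))) (-‿involutive 1#))
    0≤-1 : 0# ≤ - 1#
    0≤-1 = ≤-respˡ-≈ -0#≈0# (neg-mono-≤ h)

  1≰0 : ¬ (1# ≤ 0#)
  1≰0 h = 0≉1 (antisym 0≤1 h)

  <⇒≱ : ∀ {x y} → x < y → ¬ (y ≤ x)
  <⇒≱ = ToStrict.<⇒≱ _≈_ _≤_ antisym

  x≤x+1 : ∀ x → x ≤ x + 1#
  x≤x+1 x = ≤-respˡ-≈ (+-identityʳ x) (+-mono-≤ ≤-refl 0≤1)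

  sup-least : ∀ {P s u} → IsSupremum P s → IsUpperBound P u → s ≤ u
  sup-least {P} {s} {u} (_ , approx) ub with total s u
  ... | inj₁ s≤u = s≤u
  ... | inj₂ u≤s with s ≟ u
  ...   | yes s≈u = ≤-reflexive s≈u
  ...   | no  s≉u
            with approx (u≤s , λ u≈s → s≉u (sym u≈s))
  ...     | _ , Px , u<x = contradiction (ub Px) (<⇒≱ u<x)

  0≤fromℕ : ∀ n → 0# ≤ fromℕ n
  0≤fromℕ zero    = ≤-refl
  0≤fromℕ (suc n) = ≤-respˡ-≈ (+-identityˡ 0#) (+-mono-≤ 0≤1 (0≤fromℕ n))

  1≤fromℕ : ∀ n → .{{NonZero n}} → 1# ≤ fromℕ n
  1≤fromℕ (suc n) = ≤-respˡ-≈ (+-identityʳ 1#) (+-mono-≤ ≤-refl (0≤fromℕ n))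

  fromℕ-mono-≤ : ∀ {m n} → m ℕ.≤ n → fromℕ m ≤ fromℕ n
  fromℕ-mono-≤ {n = n} z≤n = 0≤fromℕ n
  fromℕ-mono-≤ (s≤s m≤n)   = +-mono-≤ ≤-refl (fromℕ-mono-≤ m≤n)

  fromℕ-cancel-≤ : ∀ {m n} → fromℕ m ≤ fromℕ n → m ℕ.≤ n
  fromℕ-cancel-≤ {m} {n} h with ℕ.≤-<-connex m n
  ... | inj₁ m≤n = m≤n
  ... | inj₂ n<m = contradiction 1≤0 1≰0
    where
    open ≤-R
    1≤0 : 1# ≤ 0#
    1≤0 = begin
      1#                         ≈⟨ //-rightDividesʳ (fromℕ n) 1# ⟨
      fromℕ (suc n) - fromℕ n    ≤⟨ +-monoˡ-≤ _ (≤-trans (fromℕ-mono-≤ n<m) h) ⟩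
      fromℕ n - fromℕ n          ≈⟨ -‿inverseʳ (fromℕ n) ⟩
      0#                         ∎

  archimedean : ∀ x → ∃[ n ] x ≤ fromℕ n
  archimedean x with total x 0#
  ... | inj₁ x≤0 = 0 , x≤0
  ... | inj₂ 0≤x with complete P (0# , 0 , refl , 0≤x) (x , λ (_ , _ , z≤x) → z≤x)
    where
    P : Pred Carrier 0ℓ
    P z = ∃[ n ] (z ≈ fromℕ n × z ≤ x)
  ...   | s , ub , approx with approx {s - 1#} s-1<s
    where
    s-[s-1]≈1 : s - (s - 1#) ≈ 1#
    s-[s-1]≈1 = trans (+-congˡ (-‿anti-homo‿- s 1#))
                  (trans (sym (+-assoc s 1# (- s))) (xyx⁻¹≈y s 1#))
    s-1<s : s - 1# < s
    s-1<s = 0≤-⇒≤ (≤-respʳ-≈ (sym s-[s-1]≈1) 0≤1)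
          , λ e → 0≉1 (trans (sym (-‿inverseʳ s))
                    (trans (+-congˡ (-‿cong (sym e)))
                      s-[s-1]≈1))
  ...     | z , (n , z≈n , _) , s-1<z = suc n , bound
    where
    s≤1+n : s ≤ fromℕ (suc n)
    s≤1+n = ≤-respʳ-≈ (trans (+-congʳ z≈n) (+-comm _ _))
              (≤-respˡ-≈ (//-rightDividesˡ 1# s)
                (+-monoˡ-≤ 1# (proj₁ s-1<z)))
    s≉1+n : ¬ (fromℕ (suc n) ≤ s)
    s≉1+n h = <⇒≱ s-1<z (≤-respˡ-≈ (sym z≈n)
      (≤-respˡ-≈ (xyx⁻¹≈y 1# (fromℕ n))
        (+-monoˡ-≤ (- 1#) h)))
    bound : x ≤ fromℕ (suc n)
    bound with total x (fromℕ (suc n))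
    ... | inj₁ h = h
    ... | inj₂ h = ⊥-elim (s≉1+n (ub (suc n , refl , h)))

  1≤^ : ∀ {c} → 1# ≤ c → ∀ n → 1# ≤ c ^ n
  1≤^ 1≤c zero    = ≤-refl
  1≤^ 1≤c (suc n) = ≤-respˡ-≈ (*-identityˡ 1#)
    (*-mono-≤ 0≤1 (≤-trans 0≤1 1≤c) 1≤c (1≤^ 1≤c n))

  ^-monoʳ-≤ : ∀ {c} → 1# ≤ c → ∀ {m n} → m ℕ.≤ n → c ^ m ≤ c ^ n
  ^-monoʳ-≤ 1≤c {n = n} z≤n = 1≤^ 1≤c n
  ^-monoʳ-≤ 1≤c (s≤s m≤n)   = *-monoˡ-≤ (≤-trans 0≤1 1≤c) (^-monoʳ-≤ 1≤c m≤n)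

  ^-monoˡ-≤ : ∀ n {c y} → 1# ≤ c → c ≤ y → c ^ n ≤ y ^ n
  ^-monoˡ-≤ zero    1≤c c≤y = ≤-refl
  ^-monoˡ-≤ (suc n) 1≤c c≤y =
    *-mono-≤ (≤-trans 0≤1 (1≤^ 1≤c n)) (≤-trans 0≤1 (≤-trans 1≤c c≤y))
      c≤y (^-monoˡ-≤ n 1≤c c≤y)

  ^-cancelˡ-≤ : ∀ n {c y} → 1# ≤ c → y ^ suc n ≤ c ^ suc n → y ≤ c
  ^-cancelˡ-≤ n {c} {y} 1≤c h with total y c
  ... | inj₁ y≤c = y≤c
  ... | inj₂ c≤y = 0≤-⇒≤ (≤-respʳ-≈ (-‿anti-homo‿- y c)
                     (≤-respˡ-≈ -0#≈0# (neg-mono-≤ y-c≤0)))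
    where
    open ≤-R
    1≤y = ≤-trans 1≤c c≤y
    y-c≤0 : y - c ≤ 0#
    y-c≤0 = begin
      y - c
        ≈⟨ trans (+-identityʳ _) (*-identityʳ _) ⟨
      (y - c) * 1# + 0#
        ≤⟨ +-mono-≤ (*-monoˡ-≤ (≤⇒0≤- c≤y) (1≤^ 1≤y n))
             (*-nonneg (≤-trans 0≤1 1≤c) (≤⇒0≤- (^-monoˡ-≤ n 1≤c c≤y))) ⟩
      (y - c) * y ^ n + c * (y ^ n - c ^ n)
        ≈⟨ +-cong ([y-z]x≈yx-zx (y ^ n) y c) (x[y-z]≈xy-xz c (y ^ n) (c ^ n)) ⟩
      (y ^ suc n - c * y ^ n) + (c * y ^ n - c ^ suc n)
        ≈⟨ +-assoc _ (c * y ^ n) _ ⟨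
      (y ^ suc n - c * y ^ n) + c * y ^ n - c ^ suc n
        ≈⟨ +-congʳ (//-rightDividesˡ (c * y ^ n) (y ^ suc n)) ⟩
      y ^ suc n - c ^ suc n
        ≤⟨ +-monoˡ-≤ _ h ⟩
      c ^ suc n - c ^ suc n
        ≈⟨ -‿inverseʳ _ ⟩
      0# ∎

  1≤⇒≉0 : ∀ {c} → 1# ≤ c → ¬ (c ≈ 0#)
  1≤⇒≉0 1≤c c≈0 = 1≰0 (≤-respʳ-≈ c≈0 1≤c)

  0≤⁻¹ : ∀ {c} → 1# ≤ c → 0# ≤ c ⁻¹
  0≤⁻¹ {c} 1≤c with total 0# (c ⁻¹)
  ... | inj₁ h = h
  ... | inj₂ h = contradiction 1≤0 1≰0
    where
    1≤0 : 1# ≤ 0#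
    1≤0 = ≤-respˡ-≈ (⁻¹-inverseʳ (1≤⇒≉0 1≤c))
            (≤-respʳ-≈ (zeroʳ c) (*-monoˡ-≤ (≤-trans 0≤1 1≤c) h))

  ⁻¹≤1 : ∀ {c} → 1# ≤ c → c ⁻¹ ≤ 1#
  ⁻¹≤1 {c} 1≤c = ≤-respˡ-≈ (*-identityʳ (c ⁻¹))
    (≤-respʳ-≈ (trans (*-comm _ _) (⁻¹-inverseʳ (1≤⇒≉0 1≤c)))
      (*-monoˡ-≤ (0≤⁻¹ 1≤c) 1≤c))

  IntegerDistances : Carrier → Pred Carrier 0ℓ
  IntegerDistances x d = ∃[ k ] d ≈ ∣ x - fromℤ k ∣

  0≤∣_∣ : ∀ x → 0# ≤ ∣ x ∣
  0≤∣ x ∣ with total 0# x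
  ... | inj₁ 0≤x = ≤-trans 0≤x (NaturalMax.x≤x⊔y totalOrder x (- x))
  ... | inj₂ x≤0 = ≤-trans (≤-respˡ-≈ -0#≈0# (neg-mono-≤ x≤0))
                     (NaturalMax.x≤y⊔x totalOrder x (- x))

  -- Distance to the nearest integer: ‖ x ‖ = inf { ∣ x - k ∣ : k ∈ ℤ }, with the
  -- infimum obtained as the supremum of the lower bounds.
  ‖‖-sup : ∀ x → ∃ (IsSupremum (IsLowerBound (IntegerDistances x)))
  ‖‖-sup x = complete (IsLowerBound (IntegerDistances x))
    (0# , λ (k , d≈) → ≤-respʳ-≈ (sym d≈) 0≤∣ x - fromℤ k ∣)
    (∣ x - fromℤ (+ 0) ∣ , λ lb → lb (+ 0 , refl))

  ‖_‖ : Carrier → Carrier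
  ‖ x ‖ = proj₁ (‖‖-sup x)

  _^ᶻ_ : Carrier → ℤ → Carrier
  b ^ᶻ (+ n)    = b ^ n
  b ^ᶻ -[1+ n ] = (b ^ suc n) ⁻¹

  -- For b ≥ 1, the real power b ^ x is sup { b ^ (p / q) : p / q ≤ x }, where
  -- b ^ (p / q) is the non-negative y with y ^ q = b ^ p.  In the code the
  -- denominator is suc q, and p / q need not be in lowest terms.
  RationalPowers : Carrier → Carrier → Pred Carrier 0ℓ
  RationalPowers b x y = ∃[ p ] ∃[ q ]
    (fromℤ p ≤ fromℕ (suc q) * x × 0# ≤ y × y ^ suc q ≈ b ^ᶻ p)

  rationalPowers-inhabited : ∀ b → 1# ≤ b → ∀ x → ∃ (RationalPowers b x)
  rationalPowers-inhabited b 1≤b x with archimedean (- x)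
  ... | n , -x≤n =
    (b ^ suc n) ⁻¹ , -[1+ n ] , 0 , -n≤x , 0≤⁻¹ (1≤^ 1≤b (suc n)) , *-identityʳ _
    where
    open ≤-R
    -n≤x : - fromℕ (suc n) ≤ fromℕ 1 * x
    -n≤x = begin
      - fromℕ (suc n) ≤⟨ neg-mono-≤ (fromℕ-mono-≤ (ℕ.n≤1+n n)) ⟩
      - fromℕ n       ≤⟨ neg-mono-≤ -x≤n ⟩
      - (- x)         ≈⟨ -‿involutive x ⟩
      x               ≈⟨ *-identityˡ x ⟨
      1# * x          ≈⟨ *-congʳ (+-identityʳ 1#) ⟨
      fromℕ 1 * x     ∎

  rationalPowers-bounded : ∀ b → 1# ≤ b → ∀ x → ∃ (IsUpperBound (RationalPowers b x))
  rationalPowers-bounded b 1≤b x with archimedean x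
  ... | n , x≤n = b ^ n , bound
    where
    open ≤-R
    ^ᶻ-bound : ∀ p q → fromℤ p ≤ fromℕ (suc q) * x → b ^ᶻ p ≤ b ^ (n ℕ.* suc q)
    ^ᶻ-bound (+ m) q h = ^-monoʳ-≤ 1≤b (fromℕ-cancel-≤ {m} {n ℕ.* suc q} (begin
      fromℕ m                   ≤⟨ h ⟩
      fromℕ (suc q) * x         ≤⟨ *-monoˡ-≤ (0≤fromℕ (suc q)) x≤n ⟩
      fromℕ (suc q) * fromℕ n   ≈⟨ *-comm _ _ ⟩
      fromℕ n * fromℕ (suc q)   ≈⟨ ×1-homo-* n (suc q) ⟨
      fromℕ (n ℕ.* suc q)       ∎))
    ^ᶻ-bound -[1+ m ] q _ =
      ≤-trans (⁻¹≤1 (1≤^ 1≤b (suc m))) (1≤^ 1≤b (n ℕ.* suc q))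

    bound : IsUpperBound (RationalPowers b x) (b ^ n)
    bound {y} (p , q , p≤qx , _ , y^q≈b^p) = ^-cancelˡ-≤ q (1≤^ 1≤b n) (begin
      y ^ suc q          ≈⟨ y^q≈b^p ⟩
      b ^ᶻ p             ≤⟨ ^ᶻ-bound p q p≤qx ⟩
      b ^ (n ℕ.* suc q)  ≈⟨ ^-assocʳ b n (suc q) ⟨
      (b ^ n) ^ suc q    ∎)

  rpow-sup : ∀ b → 1# ≤ b → ∀ x → ∃ (IsSupremum (RationalPowers b x))
  rpow-sup b 1≤b x = complete (RationalPowers b x)
    (rationalPowers-inhabited b 1≤b x) (rationalPowers-bounded b 1≤b x)

  rpow : ∀ b → 1# ≤ b → Carrier → Carrier
  rpow b 1≤b x = proj₁ (rpow-sup b 1≤b x)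

  infixr 8 _^ʳ_
  _^ʳ_ : (N : ℕ) → .{{NonZero N}} → Carrier → Carrier
  N ^ʳ x = rpow (fromℕ N) (1≤fromℕ N) x

  Tendsto : ((N : ℕ) → .{{NonZero N}} → Carrier) → Carrier → Set
  Tendsto a L = ∀ ε → 0# < ε →
    ∃[ N₀ ] (∀ N → .{{_ : NonZero N}} → N₀ ℕ.≤ N → ∣ a N - L ∣ < ε)

  ClosePair : (ℕ → Carrier) → Carrier → Carrier → Pred (ℕ × ℕ) 0ℓ
  ClosePair y γ r (m , n) = m ≢ n × ‖ y m - y n - γ ‖ ≤ r

  closePair? : ∀ y γ r → Decidable (ClosePair y γ r)
  closePair? y γ r (m , n) = ¬? (m ℕ.≟ n) ×-dec (‖ y m - y n - γ ‖ ≤? r)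

  pairCount : (ℕ → Carrier) → Carrier → Carrier → ℕ → ℕ
  pairCount y γ r N =
    length (filter (closePair? y γ r) (cartesianProduct [1⋯N] [1⋯N]))
    where
    [1⋯N] : List ℕ
    [1⋯N] = applyUpTo suc N

  WeakPPC : (δ γ : Carrier) → (ℕ → Carrier) → Set
  WeakPPC δ γ y = ∀ s → 0# < s →
    Tendsto (λ N → fromℕ (pairCount y γ (s / N ^ʳ δ) N) / N ^ʳ (fromℕ 2 - δ))
            (fromℕ 2 * s)

{-# OPTIONS --safe #-}
module Submission where

-- The van der Corput sequence is so evenly distributed that it has weak γ-PPC for
-- every γ.  Overwrite it on a sparse set of indices, alternately with 0 and γ₂.  Only
-- o(N) of the first N terms change, and no two changed terms differ by γ₁ modulo 1, so
-- the pairs that involve a changed term contribute o(N^(2-δ)) to the count at γ₁.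
-- At γ₂, all pairs of changed terms of opposite kind count, whatever s is.  As the
-- density of the sparse set decays slower than N^(-δ/2), there are infinitely many N at
-- which these pairs outnumber any given multiple of N^(2-δ).

open import Defs
open import Data.Nat.Base using (ℕ)
open import Data.Product.Base using (Σ-syntax; _×_)
open import Relation.Nullary.Negation using (¬_)

import Algebra.Construct.NaturalChoice.Max as NaturalMax
import Algebra.Properties.AbelianGroup as AbelianGroupProperties
import Algebra.Properties.Ring as RingProperties
import Algebra.Properties.Semiring.Mult as Mult
import Algebra.Solver.Ring as RingSolver
open import Algebra.Solver.Ring.AlmostCommutativeRing
  using (fromCommutativeRing; _-Raw-AlmostCommutative⟶_)
import Data.Integer.Base as ℤ
import Data.Integer.Properties as ℤ
open import Data.List.Base using (List; []; _∷_; _++_; map; applyUpTo; cartesianProduct; filter; length)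
open import Data.List.Properties using (filter-++; length-++; map-applyUpTo)
open import Data.Maybe.Base using (Maybe; just; nothing)
open import Data.Nat.Base as ℕ using (zero; suc; NonZero; z≤n; s≤s)
open import Data.Nat.DivMod using (m≡m%n+[m/n]*n; [m+kn]%n≡m%n; m<n⇒m%n≡m; m%n≤m; m%n<n; m/n<m)
import Data.Nat.Properties as ℕ
open import Data.Nat.Solver using (module +-*-Solver)
open import Data.Product.Base using (∃-syntax; _,_; proj₁; proj₂)
open import Data.Sum.Base using (_⊎_; inj₁; inj₂; [_,_]′)
open import Function.Base using (_∘_)
open import Level using (0ℓ)
open import Relation.Binary.Definitions using (Tri; tri<; tri≈; tri>)
open import Relation.Binary.PropositionalEquality.Core as ≡ using (_≡_)
import Relation.Binary.Construct.NonStrictToStrict as ToStrict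
import Relation.Binary.Reasoning.PartialOrder as POReasoning
open import Relation.Nullary.Decidable using (Dec; yes; no; _→-dec_; _×-dec_)
open import Relation.Nullary.Negation using (contradiction)
open import Relation.Unary using (Pred; Decidable)

-- Evenness here means that `K = 2^k` consecutive van der Corput terms, starting at a multiple of
-- `K`, form up to order an arithmetic progression of step `1/K` modulo 1. Every arc of length
-- `2r < 1`, wherever centred, then catches `⌊2rK⌋` of them or one more. With `r = s / N^δ` this
-- error of one per block is negligible only if `K` is much larger than `N^δ`, and the incomplete
-- last block only if `K` is much smaller than `N`; `0 < δ < 1` leaves room for both. As the bounds
-- are uniform in the centre, a changed term takes part in only O(N^(1-δ)) pairs with unchanged
-- ones. The values 0 and `γ₂` have differences 0 and `±γ₂`. The difference `-γ₂` is the delicate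
-- one: it misses `γ₁` modulo 1 because two distinct numbers in (0, 1/2] have a sum below 1. At
-- `N = 2^(ep)` about `N / 2^(e+1)` terms of each kind are changed, which gives `N² / 2^(2e+2)`
-- pairs. The choice of `p` makes `N^δ` at least `2^(3e)`, so these pairs exceed `N^(2-δ)` by a
-- factor of at least `2^e / 4`.

module FiniteSums where

  open import Data.Nat.Base using (_+_; _*_; _≤_; _<_; s≤s⁻¹)
  open import Data.Nat.Properties
  open import Relation.Binary.PropositionalEquality.Core using (refl; cong; cong₂; sym; trans)

  -- Finite sums of natural numbers

  ∑ : ℕ → (ℕ → ℕ) → ℕ
  ∑ zero    f = 0
  ∑ (suc n) f = ∑ n f + f n

  ∑-mono : ∀ n {f g} → (∀ {i} → i < n → f i ≤ g i) → ∑ n f ≤ ∑ n g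
  ∑-mono zero    h = z≤n
  ∑-mono (suc n) h = +-mono-≤ (∑-mono n (λ i<n → h (m<n⇒m<1+n i<n))) (h (n<1+n n))

  ∑-cong-< : ∀ n {f g} → (∀ {i} → i < n → f i ≡ g i) → ∑ n f ≡ ∑ n g
  ∑-cong-< zero    h = refl
  ∑-cong-< (suc n) h = cong₂ _+_ (∑-cong-< n (λ i<n → h (m<n⇒m<1+n i<n))) (h (n<1+n n))

  ∑-cong : ∀ n {f g} → (∀ i → f i ≡ g i) → ∑ n f ≡ ∑ n g
  ∑-cong n h = ∑-cong-< n (λ {i} _ → h i)

  ∑-monoˡ : ∀ {m n} f → m ≤ n → ∑ m f ≤ ∑ n f
  ∑-monoˡ {m} {zero}  f z≤n = z≤n
  ∑-monoˡ {m} {suc n} f m≤1+n with m ≟ suc n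
  ... | yes refl  = ≤-refl
  ... | no  m≢1+n = ≤-trans (∑-monoˡ f (s≤s⁻¹ (≤∧≢⇒< m≤1+n m≢1+n))) (m≤m+n _ _)

  ∑-+ : ∀ n f g → ∑ n (λ i → f i + g i) ≡ ∑ n f + ∑ n g
  ∑-+ zero    f g = refl
  ∑-+ (suc n) f g = trans (cong (_+ (f n + g n)) (∑-+ n f g))
    (solve 4 (λ a b c d → (a :+ b) :+ (c :+ d) := (a :+ c) :+ (b :+ d)) refl (∑ n f) (∑ n g) (f n) (g n))
    where open +-*-Solver

  ∑-const : ∀ n c → ∑ n (λ _ → c) ≡ n * c
  ∑-const zero    c = refl
  ∑-const (suc n) c = trans (cong (_+ c) (∑-const n c)) (+-comm (n * c) c)

  ∑-*ʳ : ∀ n f c → ∑ n (λ i → f i * c) ≡ ∑ n f * c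
  ∑-*ʳ zero    f c = refl
  ∑-*ʳ (suc n) f c = trans (cong (_+ f n * c) (∑-*ʳ n f c)) (sym (*-distribʳ-+ c (∑ n f) (f n)))

  ∑-*ˡ : ∀ n f c → ∑ n (λ i → c * f i) ≡ c * ∑ n f
  ∑-*ˡ n f c = trans (∑-cong n (λ i → *-comm c (f i))) (trans (∑-*ʳ n f c) (*-comm (∑ n f) c))

  ∑-comm : ∀ m n (f : ℕ → ℕ → ℕ) → ∑ m (λ i → ∑ n (f i)) ≡ ∑ n (λ j → ∑ m (λ i → f i j))
  ∑-comm zero    n f = sym (trans (∑-const n 0) (*-zeroʳ n))
  ∑-comm (suc m) n f = trans (cong (_+ ∑ n (f m)) (∑-comm m n f)) (sym (∑-+ n _ (f m)))

  ∑-++ : ∀ m n f → ∑ (m + n) f ≡ ∑ m f + ∑ n (λ i → f (m + i))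
  ∑-++ m zero    f rewrite +-identityʳ m = sym (+-identityʳ _)
  ∑-++ m (suc n) f rewrite +-suc m n = trans (cong (_+ f (m + n)) (∑-++ m n f)) (+-assoc (∑ m f) _ _)

  ∑-blocks : ∀ q n f → ∑ (q * n) f ≡ ∑ q (λ j → ∑ n (λ i → f (i + j * n)))
  ∑-blocks zero    n f = refl
  ∑-blocks (suc q) n f rewrite +-comm n (q * n) = trans (∑-++ (q * n) n f)
    (cong₂ _+_ (∑-blocks q n f) (∑-cong n (λ i → cong f (+-comm (q * n) i))))

  ∑-head : ∀ n f → ∑ (suc n) f ≡ f 0 + ∑ n (f ∘ suc)
  ∑-head n f = ∑-++ 1 n f

  term≤∑ : ∀ n f {i} → i < n → f i ≤ ∑ n f
  term≤∑ n f {i} i<n = ≤-trans (m≤n+m (f i) (∑ i f)) (∑-monoˡ f i<n)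

  -- Indicators, and counting as summation

  ⟦_⟧ : {P : Set} → Dec P → ℕ
  ⟦ yes _ ⟧ = 1
  ⟦ no  _ ⟧ = 0

  ⟦⟧-mono : ∀ {P Q} (P? : Dec P) (Q? : Dec Q) → (P → Q) → ⟦ P? ⟧ ≤ ⟦ Q? ⟧
  ⟦⟧-mono (no _)  _        P⇒Q = z≤n
  ⟦⟧-mono (yes _) (yes _)  P⇒Q = ≤-refl
  ⟦⟧-mono (yes p) (no ¬q)  P⇒Q = contradiction (P⇒Q p) ¬q

  ⟦⟧-cong : ∀ {P Q} (P? : Dec P) (Q? : Dec Q) → (P → Q) → (Q → P) → ⟦ P? ⟧ ≡ ⟦ Q? ⟧
  ⟦⟧-cong P? Q? P⇒Q Q⇒P = ≤-antisym (⟦⟧-mono P? Q? P⇒Q) (⟦⟧-mono Q? P? Q⇒P)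

  ⟦⟧≡1 : ∀ {P} (P? : Dec P) → P → ⟦ P? ⟧ ≡ 1
  ⟦⟧≡1 (yes _) p = refl
  ⟦⟧≡1 (no ¬p) p = contradiction p ¬p

  ⟦⟧≤1 : ∀ {P} (P? : Dec P) → ⟦ P? ⟧ ≤ 1
  ⟦⟧≤1 (yes _) = ≤-refl
  ⟦⟧≤1 (no  _) = z≤n

  module _ {A : Set} {P : Pred A 0ℓ} (P? : Decidable P) where

    private
      # : List A → ℕ
      # xs = length (filter P? xs)

    #-∷ : ∀ x xs → # (x ∷ xs) ≡ ⟦ P? x ⟧ + # xs
    #-∷ x xs with P? x
    ... | yes _ = refl
    ... | no  _ = refl

    #-++ : ∀ xs ys → # (xs ++ ys) ≡ # xs + # ys
    #-++ xs ys = trans (cong length (filter-++ P? xs ys)) (length-++ (filter P? xs))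

    #-applyUpTo : ∀ f n → # (applyUpTo f n) ≡ ∑ n (λ i → ⟦ P? (f i) ⟧)
    #-applyUpTo f zero    = refl
    #-applyUpTo f (suc n) = trans (#-∷ (f 0) _)
      (trans (cong (⟦ P? (f 0) ⟧ +_) (#-applyUpTo (f ∘ suc) n)) (sym (∑-head n _)))

  length-filter-cartesianProduct :
    ∀ {A B : Set} {P : Pred (A × B) 0ℓ} (P? : Decidable P) (f : ℕ → A) (g : ℕ → B) m n →
    length (filter P? (cartesianProduct (applyUpTo f m) (applyUpTo g n)))
      ≡ ∑ m (λ i → ∑ n (λ j → ⟦ P? (f i , g j) ⟧))
  length-filter-cartesianProduct P? f g zero    n = refl
  length-filter-cartesianProduct P? f g (suc m) n = trans (#-++ P? (map (f 0 ,_) (applyUpTo g n)) _)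
    (trans (cong₂ _+_
      (trans (cong (length ∘ filter P?) (map-applyUpTo g (f 0 ,_) n)) (#-applyUpTo P? _ n))
      (length-filter-cartesianProduct P? (f ∘ suc) g m n))
    (sym (∑-head m _)))

  ∑≤n*c : ∀ n {f} c → (∀ {i} → i < n → f i ≤ c) → ∑ n f ≤ n * c
  ∑≤n*c n c h = ≤-trans (∑-mono n h) (≤-reflexive (∑-const n c))

  n*c≤∑ : ∀ n {f} c → (∀ {i} → i < n → c ≤ f i) → n * c ≤ ∑ n f
  n*c≤∑ n c h = ≤-trans (≤-reflexive (sym (∑-const n c))) (∑-mono n h)

  ∑-<-indicator : ∀ n m → ∑ n (λ i → ⟦ i <? m ⟧) ≤ m
  ∑-<-indicator zero    m = z≤n
  ∑-<-indicator (suc n) m with n <? m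
  ... | no  _   = ≤-trans (≤-reflexive (+-identityʳ _)) (∑-<-indicator n m)
  ... | yes n<m = ≤-trans (≤-reflexive (+-comm _ 1))
    (≤-trans (s≤s (≤-trans (∑≤n*c n 1 (λ {i} _ → ⟦⟧≤1 (i <? m))) (≤-reflexive (*-identityʳ n)))) n<m)

-- A sparse set whose density decays slowly

module SparseSet where

  open FiniteSums
  open import Data.Nat.Base using (_+_; _*_; _∸_; _^_; _%_; _/_; _≤_; _<_)
  open import Data.Nat.Properties
  open import Relation.Binary.PropositionalEquality.Core using (refl; cong; sym; trans; subst)

  infixl 7 _%2^_ _/2^_
  _%2^_ _/2^_ : ℕ → ℕ → ℕ
  i %2^ e = _%_ i (2 ^ e) {{m^n≢0 2 e}}
  i /2^ e = _/_ i (2 ^ e) {{m^n≢0 2 e}}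

  n<2^n : ∀ n → n < 2 ^ n
  n<2^n zero    = s≤s z≤n
  n<2^n (suc n) = begin-strict
    suc n           ≤⟨ n<2^n n ⟩
    2 ^ n           <⟨ m<m+n (2 ^ n) (m^n>0 2 n) ⟩
    2 ^ n + 2 ^ n   ≡⟨ cong (2 ^ n +_) (+-identityʳ (2 ^ n)) ⟨
    2 ^ suc n       ∎
    where open ≤-Reasoning

  module _ (p : ℕ) where

    -- Below N = 2^(ep) this includes the numbers congruent to 0 or 1 modulo 2^(e+1),
    -- so the density of the set tends to 0, but is at least N^(-1/p) for these N.
    Sparse : ℕ → Set
    Sparse i = ∀ {e} → e < i → 2 ^ (e * p) ≤ i → i %2^ suc e < 2

    -- The bound `e < i` in `Sparse` makes the quantifier over scales finite, hence membership
    -- decidable. Its trace is the summand `suc e` in the threshold of `#sparse≤`.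
    sparse? : ∀ i → Dec (Sparse i)
    sparse? i = allUpTo? (λ e → (2 ^ (e * p) ≤? i) →-dec (i %2^ suc e <? 2)) i

    #sparse : ℕ → ℕ
    #sparse N = ∑ N (λ i → ⟦ sparse? i ⟧)

    -- From the threshold `i₀` onwards the condition at scale `e` is in force and leaves two
    -- residues modulo `G = 2^(e+1)`. Rounding `N` up to whole blocks of length `G` gives two
    -- members per block; everything below `i₀` is conceded.
    #sparse≤ : ∀ e N → #sparse N ≤ (2 ^ (e * p) + suc e) + suc (N /2^ suc e) * 2
    #sparse≤ e N = begin
      #sparse N
        ≤⟨ ∑-mono N (λ {i} _ → pointwise i) ⟩
      ∑ N (λ i → ⟦ i <? i₀ ⟧ + ⟦ i % G <? 2 ⟧)
        ≡⟨ ∑-+ N _ _ ⟩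
      ∑ N (λ i → ⟦ i <? i₀ ⟧) + ∑ N (λ i → ⟦ i % G <? 2 ⟧)
        ≤⟨ +-mono-≤ (∑-<-indicator N i₀) (∑-monoˡ _ N≤) ⟩
      i₀ + ∑ (suc (N / G) * G) (λ i → ⟦ i % G <? 2 ⟧)
        ≡⟨ cong (i₀ +_) (∑-blocks (suc (N / G)) G _) ⟩
      i₀ + ∑ (suc (N / G)) (λ j → ∑ G (λ i → ⟦ (i + j * G) % G <? 2 ⟧))
        ≤⟨ +-monoʳ-≤ i₀ (∑≤n*c (suc (N / G)) 2 (λ {j} _ → ≤-trans (∑-mono G (λ {i} i<G →
             ⟦⟧-mono ((i + j * G) % G <? 2) (i <? 2)
                 (subst (_< 2) (trans ([m+kn]%n≡m%n i j G) (m<n⇒m%n≡m i<G)))))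
             (∑-<-indicator G 2))) ⟩
      i₀ + suc (N / G) * 2 ∎
      where
      open ≤-Reasoning
      G = 2 ^ suc e
      instance
        G≢0 : NonZero G
        G≢0 = m^n≢0 2 (suc e)
      i₀ = 2 ^ (e * p) + suc e
      N≤ : N ≤ suc (N / G) * G
      N≤ = ≤-trans (≤-reflexive (m≡m%n+[m/n]*n N G)) (+-monoˡ-≤ _ (<⇒≤ (m%n<n N G)))
      pointwise : ∀ i → ⟦ sparse? i ⟧ ≤ ⟦ i <? i₀ ⟧ + ⟦ i % G <? 2 ⟧
      pointwise i with i <? i₀
      ... | yes _    = ≤-trans (⟦⟧≤1 (sparse? i)) (m≤m+n 1 _)
      ... | no  i≮i₀ = ⟦⟧-mono (sparse? i) (i % G <? 2)
        (λ sp → sp (≤-trans (m≤n+m (suc e) _) (≮⇒≥ i≮i₀)) (≤-trans (m≤m+n _ (suc e)) (≮⇒≥ i≮i₀)))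

    -- The scale `e = 4M` ensures `4M ≤ G`, so the members counted by whole blocks, multiplied by
    -- `M`, make up at most `N/2`. The remaining `M (i₀ + 2)` is constant, and `N₀` is twice that
    -- constant.
    #sparse-sublinear : ∀ M → ∃[ N₀ ] (∀ N → N₀ ≤ N → M * #sparse N ≤ N)
    #sparse-sublinear M = 2 * (M * i₀ + 2 * M) , λ N N₀≤N → *-cancelˡ-≤ 2 (begin
      2 * (M * #sparse N)                          ≤⟨ *-monoʳ-≤ 2 (*-monoʳ-≤ M (#sparse≤ e N)) ⟩
      2 * (M * (i₀ + suc (N / G) * 2))             ≡⟨ solve 3
          (λ M i q → con 2 :* (M :* (i :+ (con 1 :+ q) :* con 2))
                                                       := con 2 :* (M :* i :+ con 2 :* M) :+ q :*
                                                           (con 4 :* M)) refl M i₀ (N / G) ⟩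
      2 * (M * i₀ + 2 * M) + (N / G) * (4 * M)     ≤⟨ +-mono-≤ N₀≤N (*-monoʳ-≤ (N / G) 4M≤G) ⟩
      N + (N / G) * G                              ≤⟨ +-monoʳ-≤ N
          (≤-trans (m≤n+m _ (N % G)) (≤-reflexive (sym (m≡m%n+[m/n]*n N G)))) ⟩
      N + N                                        ≡⟨ cong (N +_) (+-identityʳ N) ⟨
      2 * N                                        ∎)
      where
      open ≤-Reasoning
      open +-*-Solver
      e = 4 * M
      G = 2 ^ suc e
      instance
        G≢0 : NonZero G
        G≢0 = m^n≢0 2 (suc e)
      i₀ = 2 ^ (e * p) + suc e
      4M≤G : 4 * M ≤ G
      4M≤G = ≤-trans (n≤1+n e) (<⇒≤ (n<2^n (suc e)))

    -- A number below `2^(ep)` is tested only at scales `e′ < e`, and there `2^(e′+1)` divides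
    -- `2^(e+1)`, so the residue is that of `b`.
    sparse-multiple+ : ∀ e {b} j → b < 2 → b + j * 2 ^ suc e < 2 ^ (e * p) → Sparse (b + j * 2 ^ suc e)
    sparse-multiple+ e {b} j b<2 i<N {e′} _ 2^e′p≤i with e ≤? e′
    ... | yes e≤e′ = contradiction (≤-trans (^-monoʳ-≤ 2 (*-monoˡ-≤ p e≤e′)) 2^e′p≤i) (<⇒≱ i<N)
    ... | no  e≰e′ = begin-strict
      (b + j * 2 ^ suc e) % 2 ^ suc e′             ≡⟨ cong (λ m → (b + m) % 2 ^ suc e′) multiple ⟩
      (b + (j * 2 ^ d) * 2 ^ suc e′) % 2 ^ suc e′  ≡⟨ [m+kn]%n≡m%n b (j * 2 ^ d) (2 ^ suc e′) ⟩
      b % 2 ^ suc e′                               ≤⟨ m%n≤m b (2 ^ suc e′) ⟩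
      b                                            <⟨ b<2 ⟩
      2                                            ∎
      where
      open ≤-Reasoning
      instance
        G≢0 : NonZero (2 ^ suc e′)
        G≢0 = m^n≢0 2 (suc e′)
      d = suc e ∸ suc e′
      multiple : j * 2 ^ suc e ≡ (j * 2 ^ d) * 2 ^ suc e′
      multiple = trans (cong (λ k → j * 2 ^ k) (sym (m∸n+n≡m (<⇒≤ (s≤s (≰⇒> e≰e′))))))
        (trans (cong (j *_) (^-distribˡ-+-* 2 d (suc e′))) (sym (*-assoc j (2 ^ d) (2 ^ suc e′))))

    -- Each of the `Q` blocks of even length `G` contributes its element number `b`, which has
    -- parity `b`. Parity decides which of the two values a changed term takes, so both kinds occur
    -- at least `Q` times.
    #sparse-parity : ∀ e Q {b} → b < 2 → Q * 2 ^ suc e ≡ 2 ^ (e * p) →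
      Q ≤ ∑ (2 ^ (e * p)) (λ i → ⟦ sparse? i ×-dec (i % 2 ≟ b) ⟧)
    #sparse-parity e Q {b} b<2 QG≡N = begin
      Q                                                     ≡⟨ *-identityʳ Q ⟨
      Q * 1                                                 ≤⟨ n*c≤∑ Q 1
          (λ {j} j<Q → ≤-trans (≤-reflexive (sym (f≡1 j j<Q))) (term≤∑ G _ b<G)) ⟩
      ∑ Q (λ j → ∑ G (λ i → f (i + j * G)))                 ≡⟨ ∑-blocks Q G f ⟨
      ∑ (Q * G) f                                           ≡⟨ cong (λ n → ∑ n f) QG≡N ⟩
      ∑ (2 ^ (e * p)) f                                     ∎
      where
      open ≤-Reasoning
      G = 2 ^ suc e
      f : ℕ → ℕ
      f i = ⟦ sparse? i ×-dec (i % 2 ≟ b) ⟧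
      b<G : b < G
      b<G = ≤-trans b<2 (*-monoʳ-≤ 2 (m^n>0 2 e))
      parity : ∀ j → (b + j * G) % 2 ≡ b
      parity j = trans (cong (λ m → (b + m) % 2)
          (trans (cong (j *_) (*-comm 2 (2 ^ e))) (sym (*-assoc j (2 ^ e) 2))))
        (trans ([m+kn]%n≡m%n b (j * 2 ^ e) 2) (m<n⇒m%n≡m b<2))
      f≡1 : ∀ j → j < Q → f (b + j * G) ≡ 1
      f≡1 j j<Q = ⟦⟧≡1 (sparse? (b + j * G) ×-dec ((b + j * G) % 2 ≟ b))
        ((λ {e′} → sparse-multiple+ e j b<2 i<N {e′}) , parity j)
        where
        i<N : b + j * G < 2 ^ (e * p)
        i<N = begin-strict
          b + j * G       <⟨ +-monoˡ-< (j * G) b<G ⟩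
          G + j * G       ≤⟨ *-monoˡ-≤ G j<Q ⟩
          Q * G           ≡⟨ QG≡N ⟩
          2 ^ (e * p)     ∎

module WeakPairCorrelation (R : CompleteOrderedField) where

  open import Data.Integer.Base using (ℤ; +_; -[1+_])
  open RealAnalysis R
  open FiniteSums
  open SparseSet
  open Mult semiring using (×-homo-+; ×1-homo-*)
  open RingProperties ring using (-0#≈0#; -‿involutive; -‿distribˡ-*; -‿distribʳ-*)
  open AbelianGroupProperties +-abelianGroup using (⁻¹-∙-comm)
  module ≤-R = POReasoning poset

  -- The embedding of the integers, and a ring solver over it

  fromℕ-+ : ∀ m n → fromℕ (m ℕ.+ n) ≈ fromℕ m + fromℕ n
  fromℕ-+ = ×-homo-+ 1#

  fromℕ-* : ∀ m n → fromℕ (m ℕ.* n) ≈ fromℕ m * fromℕ n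
  fromℕ-* = ×1-homo-*

  fromℤ-neg : ∀ i → fromℤ (ℤ.- i) ≈ - fromℤ i
  fromℤ-neg (+ zero)  = sym -0#≈0#
  fromℤ-neg (+ suc n) = refl
  fromℤ-neg -[1+ n ]  = sym (-‿involutive _)

  cancel-+ˡ : ∀ a b c → (a + b) - (a + c) ≈ b - c
  cancel-+ˡ a b c = begin-equality
    (a + b) - (a + c)       ≈⟨ +-cong (+-comm a b) (sym (⁻¹-∙-comm a c)) ⟩
    (b + a) + (- a + - c)   ≈⟨ +-assoc b a _ ⟩
    b + (a + (- a + - c))   ≈⟨ +-congˡ (+-assoc a (- a) (- c)) ⟨
    b + ((a + - a) + - c)   ≈⟨ +-congˡ (trans (+-congʳ (-‿inverseʳ a)) (+-identityˡ _)) ⟩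
    b - c                   ∎
    where open ≤-R

  fromℤ-⊖ : ∀ m n → fromℤ (m ℤ.⊖ n) ≈ fromℕ m - fromℕ n
  fromℤ-⊖ zero    zero    = sym (-‿inverseʳ 0#)
  fromℤ-⊖ zero    (suc n) = sym (+-identityˡ _)
  fromℤ-⊖ (suc m) zero    = sym (trans (+-congˡ -0#≈0#) (+-identityʳ _))
  fromℤ-⊖ (suc m) (suc n) = begin-equality
    fromℤ (suc m ℤ.⊖ suc n)     ≡⟨ ≡.cong fromℤ (ℤ.[1+m]⊖[1+n]≡m⊖n m n) ⟩
    fromℤ (m ℤ.⊖ n)             ≈⟨ fromℤ-⊖ m n ⟩
    fromℕ m - fromℕ n           ≈⟨ cancel-+ˡ 1# _ _ ⟨
    fromℕ (suc m) - fromℕ (suc n) ∎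
    where open ≤-R

  fromℤ-+ : ∀ i j → fromℤ (i ℤ.+ j) ≈ fromℤ i + fromℤ j
  fromℤ-+ (+ m)    (+ n)    = fromℕ-+ m n
  fromℤ-+ (+ m)    -[1+ n ] = fromℤ-⊖ m (suc n)
  fromℤ-+ -[1+ m ] (+ n)    = trans (fromℤ-⊖ n (suc m)) (+-comm _ _)
  fromℤ-+ -[1+ m ] -[1+ n ] = begin-equality
    - fromℕ (suc (suc (m ℕ.+ n)))          ≡⟨ ≡.cong (λ k → - fromℕ (suc k)) (ℕ.+-suc m n) ⟨
    - fromℕ (suc m ℕ.+ suc n)              ≈⟨ -‿cong (fromℕ-+ (suc m) (suc n)) ⟩
    - (fromℕ (suc m) + fromℕ (suc n))      ≈⟨ ⁻¹-∙-comm _ _ ⟨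
    - fromℕ (suc m) + - fromℕ (suc n)      ∎
    where open ≤-R

  fromℤ-+* : ∀ m j → fromℤ (+ m ℤ.* j) ≈ fromℕ m * fromℤ j
  fromℤ-+* m (+ n) = begin-equality
    fromℤ (+ m ℤ.* + n)  ≡⟨ ≡.cong fromℤ (ℤ.pos-* m n) ⟨
    fromℕ (m ℕ.* n)      ≈⟨ fromℕ-* m n ⟩
    fromℕ m * fromℕ n    ∎
    where open ≤-R
  fromℤ-+* m -[1+ n ] = begin-equality
    fromℤ (+ m ℤ.* -[1+ n ])            ≡⟨ ≡.cong fromℤ (ℤ.neg-distribʳ-* (+ m) (+ suc n)) ⟨
    fromℤ (ℤ.- (+ m ℤ.* + suc n))       ≈⟨ fromℤ-neg (+ m ℤ.* + suc n) ⟩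
    - fromℤ (+ m ℤ.* + suc n)           ≈⟨ -‿cong (fromℤ-+* m (+ suc n)) ⟩
    - (fromℕ m * fromℕ (suc n))         ≈⟨ -‿distribʳ-* _ _ ⟩
    fromℕ m * - fromℕ (suc n)           ∎
    where open ≤-R

  fromℤ-* : ∀ i j → fromℤ (i ℤ.* j) ≈ fromℤ i * fromℤ j
  fromℤ-* (+ m)    j = fromℤ-+* m j
  fromℤ-* -[1+ m ] j = begin-equality
    fromℤ (-[1+ m ] ℤ.* j)          ≡⟨ ≡.cong fromℤ (ℤ.neg-distribˡ-* (+ suc m) j) ⟨
    fromℤ (ℤ.- (+ suc m ℤ.* j))     ≈⟨ fromℤ-neg (+ suc m ℤ.* j) ⟩
    - fromℤ (+ suc m ℤ.* j)         ≈⟨ -‿cong (fromℤ-+* (suc m) j) ⟩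
    - (fromℕ (suc m) * fromℤ j)     ≈⟨ -‿distribˡ-* _ _ ⟩
    - fromℕ (suc m) * fromℤ j       ∎
    where open ≤-R

  -- Agrees with fromℤ up to ≈, but sends 1 to 1# on the nose, so that the
  -- coefficient 1 of the solver matches the literal 1#.
  fromℤ′ : ℤ → Carrier
  fromℤ′ (+ 1) = 1#
  fromℤ′ i     = fromℤ i

  fromℤ′≈ : ∀ i → fromℤ′ i ≈ fromℤ i
  fromℤ′≈ (+ 0)           = refl
  fromℤ′≈ (+ 1)           = sym (+-identityʳ 1#)
  fromℤ′≈ (+ suc (suc n)) = refl
  fromℤ′≈ -[1+ n ]        = refl

  fromℤ′-morphism :
    ℤ.+-*-rawRing -Raw-AlmostCommutative⟶ fromCommutativeRing commutativeRing
  fromℤ′-morphism = record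
    { ⟦_⟧    = fromℤ′
    ; +-homo = λ i j → trans (fromℤ′≈ (i ℤ.+ j))
                 (trans (fromℤ-+ i j) (sym (+-cong (fromℤ′≈ i) (fromℤ′≈ j))))
    ; *-homo = λ i j → trans (fromℤ′≈ (i ℤ.* j))
                 (trans (fromℤ-* i j) (sym (*-cong (fromℤ′≈ i) (fromℤ′≈ j))))
    ; -‿homo = λ i → trans (fromℤ′≈ (ℤ.- i))
                 (trans (fromℤ-neg i) (sym (-‿cong (fromℤ′≈ i))))
    ; 0-homo = refl
    ; 1-homo = refl
    }

  fromℤ′-≟ : ∀ i j → Maybe (fromℤ′ i ≈ fromℤ′ j)
  fromℤ′-≟ i j with i ℤ.≟ j
  ... | yes i≡j = just (reflexive (≡.cong fromℤ′ i≡j))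
  ... | no  _   = nothing

  open RingSolver ℤ.+-*-rawRing (fromCommutativeRing commutativeRing)
         fromℤ′-morphism fromℤ′-≟ public
    using (solve; _:=_; _:+_; _:*_; _:-_; :-_; con; Polynomial)

  :1 :2 : ∀ {n} → Polynomial n
  :1 = con (+ 1)
  :2 = con (+ 2)

  -- Order arithmetic and integer parts

  2# : Carrier
  2# = fromℕ 2

  infixl 6 _⊕_
  infixl 7 _⊗_

  _⊕_ : ∀ {x y} → 0# ≤ x → 0# ≤ y → 0# ≤ x + y
  p ⊕ q = ≤-respˡ-≈ (+-identityˡ 0#) (+-mono-≤ p q)

  _⊗_ : ∀ {x y} → 0# ≤ x → 0# ≤ y → 0# ≤ x * y
  _⊗_ = *-nonneg

  -- Inequalities are proved by certificates: `_⊕_` and `_⊗_` assemble an expression `e` that is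
  -- visibly non-negative, and the ring solver checks that it equals the difference of the two
  -- sides.
  ≤-by : ∀ {x y e} → 0# ≤ e → y - x ≈ e → x ≤ y
  ≤-by 0≤e y-x≈e = 0≤-⇒≤ (≤-respʳ-≈ (sym y-x≈e) 0≤e)

  <⇒≤ : ∀ {x y} → x < y → x ≤ y
  <⇒≤ = proj₁

  ≰⇒> : ∀ {x y} → ¬ (x ≤ y) → y < x
  ≰⇒> = ToStrict.≰⇒> _≈_ _≤_ sym ≤-reflexive total

  <-≤-trans : ∀ {x y z} → x < y → y ≤ z → x < z
  <-≤-trans = ToStrict.<-≤-trans _≈_ _≤_ sym ≤-trans antisym ≤-respʳ-≈

  ≤-<-trans : ∀ {x y z} → x ≤ y → y < z → x < z
  ≤-<-trans = ToStrict.≤-<-trans _≈_ _≤_ ≤-trans antisym ≤-respˡ-≈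

  <⇒0<- : ∀ {x y} → x < y → 0# < y - x
  <⇒0<- {x} {y} (x≤y , x≉y) = ≤⇒0≤- x≤y , λ 0≈y-x → x≉y (begin-equality
    x            ≈⟨ +-identityʳ x ⟨
    x + 0#       ≈⟨ +-congˡ 0≈y-x ⟩
    x + (y - x)  ≈⟨ solve 2 (λ x y → x :+ (y :- x) := y) refl x y ⟩
    y            ∎)
    where open ≤-R

  0<-⇒< : ∀ {x y} → 0# < y - x → x < y
  0<-⇒< {x} {y} (h , n) = 0≤-⇒≤ h , λ x≈y → n (sym (trans (+-congˡ (-‿cong x≈y)) (-‿inverseʳ y)))

  0<1 : 0# < 1#
  0<1 = 0≤1 , 0≉1

  1≤⇒0≤ : ∀ {x} → 1# ≤ x → 0# ≤ x
  1≤⇒0≤ = ≤-trans 0≤1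

  1≤⇒0< : ∀ {x} → 1# ≤ x → 0# < x
  1≤⇒0< = <-≤-trans 0<1

  ⁻¹-inverseʳ⁺ : ∀ {x} → 0# < x → x * x ⁻¹ ≈ 1#
  ⁻¹-inverseʳ⁺ (_ , 0≉x) = ⁻¹-inverseʳ (λ x≈0 → 0≉x (sym x≈0))

  ⁻¹-nonneg : ∀ {x} → 0# < x → 0# ≤ x ⁻¹
  ⁻¹-nonneg {x} 0<x with total 0# (x ⁻¹)
  ... | inj₁ h = h
  ... | inj₂ h = contradiction 1≤0 1≰0
    where
    1≤0 : 1# ≤ 0#
    1≤0 = ≤-respˡ-≈ (⁻¹-inverseʳ⁺ 0<x)
            (≤-respʳ-≈ (zeroʳ x) (*-monoˡ-≤ (<⇒≤ 0<x) h))

  *-cancelʳ-≤ : ∀ {x y z} → 0# < z → x * z ≤ y * z → x ≤ y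
  *-cancelʳ-≤ {x} {y} {z} 0<z h = begin
    x               ≈⟨ *-identityʳ x ⟨
    x * 1#          ≈⟨ *-congˡ z*z⁻¹ ⟨
    x * (z * z ⁻¹)  ≈⟨ solve 3 (λ x z w → x :* (z :* w) := w :* (x :* z)) refl x z (z ⁻¹) ⟩
    z ⁻¹ * (x * z)  ≤⟨ *-monoˡ-≤ (⁻¹-nonneg 0<z) h ⟩
    z ⁻¹ * (y * z)  ≈⟨ solve 3 (λ x z w → w :* (x :* z) := x :* (z :* w)) refl y z (z ⁻¹) ⟩
    y * (z * z ⁻¹)  ≈⟨ *-congˡ z*z⁻¹ ⟩
    y * 1#          ≈⟨ *-identityʳ y ⟩
    y               ∎
    where
    open ≤-R
    z*z⁻¹ = ⁻¹-inverseʳ⁺ 0<z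

  *-monoʳ-≤ : ∀ {z x y} → 0# ≤ z → x ≤ y → x * z ≤ y * z
  *-monoʳ-≤ 0≤z x≤y = ≤-respˡ-≈ (*-comm _ _) (≤-respʳ-≈ (*-comm _ _) (*-monoˡ-≤ 0≤z x≤y))

  *-cancelʳ-< : ∀ {x y z} → 0# ≤ z → x * z < y * z → x < y
  *-cancelʳ-< 0≤z h = ≰⇒> (λ y≤x → <⇒≱ h (*-monoʳ-≤ 0≤z y≤x))

  *-monoʳ-< : ∀ {x y z} → 0# < z → x < y → x * z < y * z
  *-monoʳ-< 0<z h = ≰⇒> (λ k → <⇒≱ h (*-cancelʳ-≤ 0<z k))

  ⁻¹-pos : ∀ {x} → 0# < x → 0# < x ⁻¹
  ⁻¹-pos {x} 0<x = ⁻¹-nonneg 0<x , λ 0≈x⁻¹ →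
    0≉1 (trans (sym (trans (*-congˡ (sym 0≈x⁻¹)) (zeroʳ x))) (⁻¹-inverseʳ⁺ 0<x))

  n<1+n : ∀ n → fromℕ n < fromℕ (suc n)
  n<1+n n = 0<-⇒< (<-≤-trans 0<1 (≤-reflexive
              (solve 1 (λ n → :1 := :1 :+ n :- n) refl (fromℕ n))))

  archimedean-multiple : ∀ x {g} → 0# < g → ∃[ n ] x < fromℕ (suc n) * g
  archimedean-multiple x {g} 0<g =
    let n , x/g≤n = archimedean (x / g) in n , (begin-strict
    x                   ≈⟨ *-identityʳ x ⟨
    x * 1#              ≈⟨ *-congˡ (⁻¹-inverseʳ⁺ 0<g) ⟨
    x * (g * g ⁻¹)      ≈⟨ solve 3 (λ x g w → x :* (g :* w) := (x :* w) :* g) refl x g (g ⁻¹) ⟩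
    x / g * g           ≤⟨ *-monoʳ-≤ (<⇒≤ 0<g) x/g≤n ⟩
    fromℕ n * g         <⟨ *-monoʳ-< 0<g (n<1+n n) ⟩
    fromℕ (suc n) * g   ∎)
    where open ≤-R

  floor : ∀ {x} → 0# ≤ x → ∃[ n ] (fromℕ n ≤ x × x < fromℕ (suc n))
  floor {x} 0≤x = below (proj₁ (archimedean x)) (proj₂ (archimedean x))
    where
    below : ∀ m → x ≤ fromℕ m → ∃[ n ] (fromℕ n ≤ x × x < fromℕ (suc n))
    below m x≤m with fromℕ m ≤? x
    ... | yes m≤x = m , m≤x , ≤-<-trans x≤m (n<1+n m)
    below zero    x≤m | no m≰x = contradiction 0≤x m≰x
    below (suc m) x≤m | no m≰x with total x (fromℕ m)
    ... | inj₁ x≤m′ = below m x≤m′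
    ... | inj₂ m≤x  = m , m≤x , ≰⇒> m≰x

  -- Powers and roots

  ^-nonneg : ∀ {x} n → 0# ≤ x → 0# ≤ x ^ n
  ^-nonneg zero    0≤x = 0≤1
  ^-nonneg (suc n) 0≤x = 0≤x ⊗ ^-nonneg n 0≤x

  -- The quantitative continuity of powers on which the existence of roots rests. The induction
  -- splits `z^(n+1) - y^(n+1)` as `(z - y) z^n + y (z^n - y^n)`.
  ^-lipschitz : ∀ n B → 1# ≤ B → ∃[ C ] (0# ≤ C ×
    (∀ {y z} → 0# ≤ y → y ≤ z → z ≤ B → z ^ n - y ^ n ≤ (z - y) * C))
  ^-lipschitz zero    B 1≤B = 0# , ≤-refl , λ {y} {z} _ _ _ →
    ≤-reflexive (solve 2 (λ y z → :1 :- :1 := (z :- y) :* con (+ 0)) refl y z)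
  ^-lipschitz (suc n) B 1≤B with ^-lipschitz n B 1≤B
  ... | C , 0≤C , lip = B ^ n + B * C , ^-nonneg n 0≤B ⊕ 0≤B ⊗ 0≤C , bound
    where
    open ≤-R
    0≤B = 1≤⇒0≤ 1≤B
    ^-monoˡ : ∀ k {x y} → 0# ≤ x → x ≤ y → x ^ k ≤ y ^ k
    ^-monoˡ zero    _   _   = ≤-refl
    ^-monoˡ (suc k) 0≤x x≤y = *-mono-≤ (^-nonneg k 0≤x) (≤-trans 0≤x x≤y) x≤y (^-monoˡ k 0≤x x≤y)
    bound : ∀ {y z} → 0# ≤ y → y ≤ z → z ≤ B → z ^ suc n - y ^ suc n ≤ (z - y) * (B ^ n + B * C)
    bound {y} {z} 0≤y y≤z z≤B = begin
      z * z ^ n - y * y ^ n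
        ≈⟨ solve 4 (λ y z u v → z :* u :- y :* v := (z :- y) :* u :+ y :* (u :- v)) refl y z (z ^ n)
            (y ^ n) ⟩
      (z - y) * z ^ n + y * (z ^ n - y ^ n)
        ≤⟨ +-mono-≤ (*-monoˡ-≤ 0≤z-y (^-monoˡ n (≤-trans 0≤y y≤z) z≤B))
             (*-monoˡ-≤ 0≤y (lip 0≤y y≤z z≤B)) ⟩
      (z - y) * B ^ n + y * ((z - y) * C)
        ≤⟨ +-mono-≤ ≤-refl (*-monoʳ-≤ (0≤z-y ⊗ 0≤C) (≤-trans y≤z z≤B)) ⟩
      (z - y) * B ^ n + B * ((z - y) * C)
        ≈⟨ solve 4 (λ d b B C → d :* b :+ B :* (d :* C) := d :* (b :+ B :* C)) refl (z - y) (B ^ n) B C ⟩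
      (z - y) * (B ^ n + B * C) ∎
      where 0≤z-y = ≤⇒0≤- y≤z

  bernoulli : ∀ n {h} → 0# ≤ h → 1# + fromℕ n * h ≤ (1# + h) ^ n
  bernoulli zero    {h} 0≤h = ≤-reflexive (solve 1 (λ h → :1 :+ con (+ 0) :* h := :1) refl h)
  bernoulli (suc n) {h} 0≤h = begin
    1# + (1# + fromℕ n) * h         ≤⟨ ≤-by (0≤fromℕ n ⊗ 0≤h ⊗ 0≤h)
      (solve 2 (λ h n → (:1 :+ h) :* (:1 :+ n :* h) :- (:1 :+ (:1 :+ n) :* h) := n :* h :* h) refl h
          (fromℕ n)) ⟩
    (1# + h) * (1# + fromℕ n * h)   ≤⟨ *-monoˡ-≤ (0≤1 ⊕ 0≤h) (bernoulli n 0≤h) ⟩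
    (1# + h) * (1# + h) ^ n         ∎
    where open ≤-R

  -- Taking `h` to be the reciprocal of a positive integer also gives `h ≤ 1`, which keeps `z + h`
  -- in the range of the Lipschitz bound on `[0, z + 1]`.
  small-multiple : ∀ C {g} → 0# < g → ∃[ h ] (0# < h × h ≤ 1# × h * C < g)
  small-multiple C {g} 0<g = h , ⁻¹-pos 0<n , ⁻¹≤1 1≤n , (begin-strict
    h * C                ≈⟨ *-comm h C ⟩
    C * h                <⟨ *-monoʳ-< (⁻¹-pos 0<n) (proj₂ arch) ⟩
    n * g * h            ≈⟨ solve 3 (λ n g h → n :* g :* h := g :* (n :* h)) refl n g h ⟩
    g * (n * h)          ≈⟨ *-congˡ (⁻¹-inverseʳ⁺ 0<n) ⟩
    g * 1#               ≈⟨ *-identityʳ g ⟩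
    g                    ∎)
    where
    open ≤-R
    arch = archimedean-multiple C 0<g
    n = fromℕ (suc (proj₁ arch))
    1≤n = 1≤fromℕ (suc (proj₁ arch))
    0<n = 1≤⇒0< 1≤n
    h = n ⁻¹

  1^≈1 : ∀ n → 1# ^ n ≈ 1#
  1^≈1 zero    = refl
  1^≈1 (suc n) = trans (*-identityˡ _) (1^≈1 n)

  ^-increase : ∀ n {b z} → 1# ≤ z → z ^ n < b → ∃[ h ] (0# < h × (z + h) ^ n ≤ b)
  ^-increase n {b} {z} 1≤z z^<b =
    let C , 0≤C , lip        = ^-lipschitz n (z + 1#) (≤-trans 1≤z (x≤x+1 z))
        h , 0<h , h≤1 , hC<g = small-multiple C (<⇒0<- z^<b)
        z≤z+h                = ≤-by (<⇒≤ 0<h) (solve 2 (λ z h → z :+ h :- z := h) refl z h)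
    in h , 0<h , (begin
      (z + h) ^ n                    ≈⟨ solve 2 (λ x y → x := (x :- y) :+ y) refl ((z + h) ^ n) (z ^ n) ⟩
      (z + h) ^ n - z ^ n + z ^ n    ≤⟨ +-monoˡ-≤ _ (lip (1≤⇒0≤ 1≤z) z≤z+h (+-mono-≤ ≤-refl h≤1)) ⟩
      (z + h - z) * C + z ^ n        ≈⟨ +-congʳ (*-congʳ (solve 2 (λ z h → z :+ h :- z := h) refl z h)) ⟩
      h * C + z ^ n                  ≤⟨ +-monoˡ-≤ _ (<⇒≤ hC<g) ⟩
      b - z ^ n + z ^ n              ≈⟨ solve 2 (λ b y → b :- y :+ y := b) refl b (z ^ n) ⟩
      b                              ∎)
    where open ≤-R

  -- Stated for every `y` close below `z`, not just for one, because a supremum supplies only some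
  -- member of its set in that range.
  ^-decrease : ∀ n {b z} → 1# ≤ z → b < z ^ n →
               ∃[ h ] (0# < h × (∀ {y} → 1# ≤ y → y ≤ z → z - h < y → b < y ^ n))
  ^-decrease n {b} {z} 1≤z b<z^ =
    let C , 0≤C , lip        = ^-lipschitz n z 1≤z
        h , 0<h , h≤1 , hC<g = small-multiple C (<⇒0<- b<z^)
    in h , 0<h , λ {y} 1≤y y≤z z-h<y → 0<-⇒< (begin-strict
      0#                                  <⟨ <⇒0<- hC<g ⟩
      z ^ n - b - h * C                   ≤⟨ +-mono-≤ ≤-refl (neg-mono-≤ (*-monoʳ-≤ 0≤C
                                               (≤-by (≤⇒0≤- (<⇒≤ z-h<y)) (solve 3
                                                   (λ y z h → h :- (z :- y) := y :- (z :- h))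
                                                       refl y z h)))) ⟩
      z ^ n - b - (z - y) * C             ≤⟨ +-mono-≤ ≤-refl (neg-mono-≤ (lip (1≤⇒0≤ 1≤y) y≤z ≤-refl)) ⟩
      z ^ n - b - (z ^ n - y ^ n)         ≈⟨ solve 3 (λ b y z → z :- b :- (z :- y) := y :- b) refl b
          (y ^ n) (z ^ n) ⟩
      y ^ n - b                           ∎)
    where open ≤-R

  -- Roots supply the grid of powers `z^p = b^(p/(q+1))` between which `rpow` is trapped. At the
  -- supremum of the `y` with `y^n ≤ b`, a power below `b` would leave room for a larger member, and
  -- a power above `b` would leave no members near it.
  root : ∀ q {b} → 1# ≤ b → ∃[ z ] (1# ≤ z × z ^ suc q ≈ b)
  root q {b} 1≤b = z , 1≤z , antisym z^≤b b≤z^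
    where
    n = suc q
    P : Carrier → Set
    P y = 1# ≤ y × y ^ n ≤ b
    P1 : P 1#
    P1 = ≤-refl , ≤-respˡ-≈ (sym (1^≈1 n)) 1≤b
    ≤b : ∀ {y} → P y → y ≤ b
    ≤b {y} (1≤y , h) = ≤-trans (≤-respˡ-≈ (*-identityʳ y) (*-monoˡ-≤ (1≤⇒0≤ 1≤y) (1≤^ 1≤y q))) h
    supremum = complete P (1# , P1) (b , ≤b)
    z = proj₁ supremum
    ub = proj₁ (proj₂ supremum)
    1≤z : 1# ≤ z
    1≤z = ub P1
    b≤z^ : b ≤ z ^ n
    b≤z^ with b ≤? z ^ n
    ... | yes h    = h
    ... | no  b≰z^ =
      let h , 0<h , z+h^≤b = ^-increase n 1≤z (≰⇒> b≰z^)
          z<z+h = 0<-⇒< (<-≤-trans 0<h (≤-reflexive (solve 2 (λ z h → h := z :+ h :- z) refl z h)))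
      in contradiction (ub (≤-trans 1≤z (<⇒≤ z<z+h) , z+h^≤b)) (<⇒≱ z<z+h)
    z^≤b : z ^ n ≤ b
    z^≤b with z ^ n ≤? b
    ... | yes h    = h
    ... | no  z^≰b =
      let h , 0<h , b<y^ = ^-decrease n 1≤z (≰⇒> z^≰b)
          y , (1≤y , y^≤b) , z-h<y = proj₂ (proj₂ supremum)
            (0<-⇒< (<-≤-trans 0<h (≤-reflexive (solve 2 (λ z h → h := z :- (z :- h)) refl z h))))
      in contradiction y^≤b (<⇒≱ (b<y^ 1≤y (ub (1≤y , y^≤b)) z-h<y))

  ^-cong₂ : ∀ {x y m n} → x ≈ y → m ≡ n → x ^ m ≈ y ^ n
  ^-cong₂ {m = m} x≈y ≡.refl = ^-congˡ m x≈y

  fromℕ-^ : ∀ m n → fromℕ (m ℕ.^ n) ≈ fromℕ m ^ n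
  fromℕ-^ m zero    = +-identityʳ 1#
  fromℕ-^ m (suc n) = trans (fromℕ-* m (m ℕ.^ n)) (*-congˡ (fromℕ-^ m n))

  -- Real powers

  module _ {b} (1≤b : 1# ≤ b) where

    ≤-rpow : ∀ {x y} p q → fromℕ p ≤ fromℕ (suc q) * x → 0# ≤ y → y ^ suc q ≈ b ^ p →
             y ≤ rpow b 1≤b x
    ≤-rpow {x} p q p≤qx 0≤y y^q≈b^p =
      proj₁ (proj₂ (rpow-sup b 1≤b x)) (+ p , q , p≤qx , 0≤y , y^q≈b^p)

    rpow-≤ : ∀ {x u} → 1# ≤ u →
             (∀ p q → fromℕ p ≤ fromℕ (suc q) * x → b ^ p ≤ u ^ suc q) → rpow b 1≤b x ≤ u
    rpow-≤ {x} {u} 1≤u h = sup-least (proj₂ (rpow-sup b 1≤b x)) bound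
      where
      bound : ∀ {y} → RationalPowers b x y → y ≤ u
      bound (+ p , q , p≤qx , _ , y^q≈b^p) = ^-cancelˡ-≤ q 1≤u (≤-respˡ-≈ (sym y^q≈b^p) (h p q p≤qx))
      -- A negative exponent gives a power of at most 1, and `1 ≤ u`; this is why the hypothesis
      -- speaks only of natural exponents.
      bound (-[1+ p ] , q , _ , _ , y^q≈b^p) = ^-cancelˡ-≤ q 1≤u
        (≤-respˡ-≈ (sym y^q≈b^p) (≤-trans (⁻¹≤1 (1≤^ 1≤b (suc p))) (1≤^ 1≤u (suc q))))

    module _ q {z} (1≤z : 1# ≤ z) (z^q≈b : z ^ suc q ≈ b) where

      root^≤rpow : ∀ {x} p → fromℕ p ≤ fromℕ (suc q) * x → z ^ p ≤ rpow b 1≤b x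
      root^≤rpow p p≤qx = ≤-rpow p q p≤qx (^-nonneg p (1≤⇒0≤ 1≤z)) (begin-equality
        (z ^ p) ^ suc q      ≈⟨ ^-assocʳ z p (suc q) ⟩
        z ^ (p ℕ.* suc q)    ≈⟨ ^-cong₂ refl (ℕ.*-comm p (suc q)) ⟩
        z ^ (suc q ℕ.* p)    ≈⟨ ^-assocʳ z (suc q) p ⟨
        (z ^ suc q) ^ p      ≈⟨ ^-congˡ p z^q≈b ⟩
        b ^ p                ∎)
        where open ≤-R

      -- Cross-multiplying `p′/(q′+1) ≤ x ≤ p/(q+1)` reduces the comparison to natural exponents of
      -- the common base `z`.
      rpow≤root^ : ∀ {x} p → fromℕ (suc q) * x ≤ fromℕ p → rpow b 1≤b x ≤ z ^ p
      rpow≤root^ {x} p qx≤p = rpow-≤ (1≤^ 1≤z p) λ p′ q′ p′≤q′x → begin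
        b ^ p′                 ≈⟨ ^-congˡ p′ z^q≈b ⟨
        (z ^ suc q) ^ p′       ≈⟨ ^-assocʳ z (suc q) p′ ⟩
        z ^ (suc q ℕ.* p′)     ≤⟨ ^-monoʳ-≤ 1≤z (cross p′ q′ p′≤q′x) ⟩
        z ^ (p ℕ.* suc q′)     ≈⟨ ^-assocʳ z p (suc q′) ⟨
        (z ^ p) ^ suc q′       ∎
        where
        open ≤-R
        cross : ∀ p′ q′ → fromℕ p′ ≤ fromℕ (suc q′) * x → suc q ℕ.* p′ ℕ.≤ p ℕ.* suc q′
        cross p′ q′ p′≤q′x = fromℕ-cancel-≤ {suc q ℕ.* p′} {p ℕ.* suc q′} (begin
          fromℕ (suc q ℕ.* p′)               ≈⟨ fromℕ-* (suc q) p′ ⟩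
          fromℕ (suc q) * fromℕ p′           ≤⟨ *-monoˡ-≤ (0≤fromℕ (suc q)) p′≤q′x ⟩
          fromℕ (suc q) * (fromℕ (suc q′) * x) ≈⟨ solve 3 (λ a b x → a :* (b :* x) := a :* x :* b) refl
              (fromℕ (suc q)) (fromℕ (suc q′)) x ⟩
          fromℕ (suc q) * x * fromℕ (suc q′)   ≤⟨ *-monoʳ-≤ (0≤fromℕ (suc q′)) qx≤p ⟩
          fromℕ p * fromℕ (suc q′)             ≈⟨ fromℕ-* p (suc q′) ⟨
          fromℕ (p ℕ.* suc q′)                 ∎)

    1≤rpow : ∀ {x} → 0# ≤ x → 1# ≤ rpow b 1≤b x
    1≤rpow {x} 0≤x = ≤-rpow 0 0 (0≤fromℕ 1 ⊗ 0≤x) 0≤1 (*-identityʳ 1#)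

    -- Because b^(1/Q) → 1 as Q → ∞.
    ≤-root-multiples : ∀ {x y} → 0# ≤ y →
      (∀ q {z} → 1# ≤ z → z ^ suc q ≈ b → x ≤ z * y) → x ≤ y
    ≤-root-multiples {x} {y} 0≤y x≤zy with x ≤? y
    ... | yes x≤y = x≤y
    ... | no  x≰y =
      -- If `x` exceeded `y`, then `x ≤ z y` would keep every root `z` above `1 + h` for one fixed
      -- `h > 0`. Bernoulli's inequality then gives `(q + 1) h ≤ b` for all `q`, against the
      -- Archimedean property.
      let h , 0<h , _ , hy<x-y = small-multiple y (<⇒0<- (≰⇒> x≰y))
          q , b<qh             = archimedean-multiple b 0<h
          z , 1≤z , z^q≈b      = root q 1≤b
      in contradiction (qh≤b 0<h hy<x-y q 1≤z z^q≈b) (<⇒≱ b<qh)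
      where
      open ≤-R
      qh≤b : ∀ {h} → 0# < h → h * y < x - y → ∀ q {z} → 1# ≤ z → z ^ suc q ≈ b → fromℕ (suc q) * h ≤ b
      qh≤b {h} 0<h hy<x-y q {z} 1≤z z^q≈b = begin
        fromℕ (suc q) * h           ≤⟨ ≤-by 0≤1
            (solve 1 (λ u → :1 :+ u :- u := :1) refl (fromℕ (suc q) * h)) ⟩
        1# + fromℕ (suc q) * h      ≤⟨ bernoulli (suc q) (<⇒≤ 0<h) ⟩
        (1# + h) ^ suc q            ≤⟨ ^-monoˡ-≤ (suc q)
            (≤-by (<⇒≤ 0<h) (solve 1 (λ h → :1 :+ h :- :1 := h) refl h)) 1+h≤z ⟩
        z ^ suc q                   ≈⟨ z^q≈b ⟩
        b                           ∎
        where
        1+h≤z : 1# + h ≤ z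
        1+h≤z with total (1# + h) z
        ... | inj₁ p = p
        ... | inj₂ z≤1+h = contradiction (x≤zy q 1≤z z^q≈b) (<⇒≱ (begin-strict
          z * y           ≤⟨ *-monoʳ-≤ 0≤y z≤1+h ⟩
          (1# + h) * y    ≈⟨ solve 2 (λ h y → (:1 :+ h) :* y := h :* y :+ y) refl h y ⟩
          h * y + y       <⟨ 0<-⇒< (<-≤-trans (<⇒0<- hy<x-y) (≤-reflexive
                                (solve 3 (λ hy x y → x :- y :- hy := x :- (hy :+ y)) refl (h * y) x y))) ⟩
          x               ∎))

    -- The one instance of additivity of exponents that links `N^(2-δ)` to `N^δ`. For a root `z` of
    -- order `Q`, both factors lie between consecutive powers of `z`, namely `z^p`, `z^(p+1)` and
    -- `z^p′`, `z^(p′+1)` with `p + p′ + 1 = 2Q`. The product thus equals `z^(2Q) = b²` up to a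
    -- factor `z`, which `≤-root-multiples` removes.
    rpow-complement : ∀ {x} → 0# ≤ x → x ≤ 1# → rpow b 1≤b (2# - x) * rpow b 1≤b x ≈ b * b
    rpow-complement {x} 0≤x x≤1 =
      antisym (≤-root-multiples 0≤b*b λ q 1≤z e → proj₁ (sandwich q 1≤z e))
              (≤-root-multiples 0≤P   λ q 1≤z e → proj₂ (sandwich q 1≤z e))
      where
      open ≤-R
      0≤b = 1≤⇒0≤ 1≤b
      0≤b*b = 0≤b ⊗ 0≤b
      D = rpow b 1≤b x
      E = rpow b 1≤b (2# - x)
      0≤2-x : 0# ≤ 2# - x
      0≤2-x = ≤-respʳ-≈ (solve 1 (λ x → :1 :- x :+ :1 := :2 :- x) refl x) (≤⇒0≤- x≤1 ⊕ 0≤1)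
      0≤D = 1≤⇒0≤ (1≤rpow 0≤x)
      0≤E = 1≤⇒0≤ (1≤rpow 0≤2-x)
      0≤P = 0≤E ⊗ 0≤D
      sandwich : ∀ q {z} → 1# ≤ z → z ^ suc q ≈ b → E * D ≤ z * (b * b) × b * b ≤ z * (E * D)
      sandwich q {z} 1≤z z^q≈b = upper , lower
        where
        Q = fromℕ (suc q)
        ⌊Qx⌋ = floor (0≤fromℕ (suc q) ⊗ 0≤x)
        p = proj₁ ⌊Qx⌋
        p≤Qx = proj₁ (proj₂ ⌊Qx⌋)
        Qx<p+1 = proj₂ (proj₂ ⌊Qx⌋)
        p≤Q : p ℕ.≤ suc q
        p≤Q = fromℕ-cancel-≤ {p} {suc q}
            (≤-trans p≤Qx (≤-respʳ-≈ (*-identityʳ Q) (*-monoˡ-≤ (0≤fromℕ (suc q)) x≤1)))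
        -- This is `2Q - p - 1` with `Q = q + 1`, arranged so that the subtraction does not
        -- truncate: `p ≤ Q` because `x ≤ 1`.
        p′ = q ℕ.+ (suc q ℕ.∸ p)
        p+p′ : p ℕ.+ suc p′ ≡ suc q ℕ.+ suc q
        p+p′ = ≡.trans (ℕ.+-suc p p′) (≡.cong suc
          (≡.trans (≡.cong (p ℕ.+_) (ℕ.+-comm q _))
            (≡.trans (≡.sym (ℕ.+-assoc p (suc q ℕ.∸ p) q))
              (≡.trans (≡.cong (ℕ._+ q) (ℕ.m+[n∸m]≡n p≤Q)) (≡.sym (ℕ.+-suc q q))))))
        ℕp+p′ : fromℕ p + fromℕ (suc p′) ≈ Q + Q
        ℕp+p′ = trans (sym (fromℕ-+ p (suc p′)))
            (trans (reflexive (≡.cong fromℕ p+p′)) (fromℕ-+ (suc q) (suc q)))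
        p′≤ : fromℕ p′ ≤ Q * (2# - x)
        p′≤ = ≤-by (≤⇒0≤- (<⇒≤ Qx<p+1)) (begin-equality
          Q * (2# - x) - fromℕ p′
            ≈⟨ solve 4 (λ Q x p p′ → Q :* (:2 :- x) :- p′ := (Q :+ Q) :+ (:1 :- Q :* x :- (:1 :+ p′)))
                refl Q x (fromℕ p) (fromℕ p′) ⟩
          (Q + Q) + (1# - Q * x - fromℕ (suc p′))
            ≈⟨ +-congʳ ℕp+p′ ⟨
          fromℕ p + fromℕ (suc p′) + (1# - Q * x - fromℕ (suc p′))
            ≈⟨ solve 3 (λ u p s → p :+ s :+ (:1 :- u :- s) := :1 :+ p :- u) refl (Q * x) (fromℕ p)
                (fromℕ (suc p′)) ⟩
          fromℕ (suc p) - Q * x ∎)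
        ≤p′ : Q * (2# - x) ≤ fromℕ (suc p′)
        ≤p′ = ≤-by (≤⇒0≤- p≤Qx) (begin-equality
          fromℕ (suc p′) - Q * (2# - x)
            ≈⟨ solve 4 (λ Q x p s → s :- Q :* (:2 :- x) := (p :+ s) :- (Q :+ Q) :+ (Q :* x :- p))
                refl Q x (fromℕ p) (fromℕ (suc p′)) ⟩
          fromℕ p + fromℕ (suc p′) - (Q + Q) + (Q * x - fromℕ p)
            ≈⟨ +-congʳ (+-congʳ ℕp+p′) ⟩
          (Q + Q) - (Q + Q) + (Q * x - fromℕ p)
            ≈⟨ solve 2 (λ Q u → Q :- Q :+ u := u) refl (Q + Q) (Q * x - fromℕ p) ⟩
          Q * x - fromℕ p ∎)
        z^ : z ^ p * z ^ suc p′ ≈ b * b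
        z^ = begin-equality
          z ^ p * z ^ suc p′        ≈⟨ ^-homo-* z p (suc p′) ⟨
          z ^ (p ℕ.+ suc p′)        ≈⟨ ^-cong₂ refl p+p′ ⟩
          z ^ (suc q ℕ.+ suc q)     ≈⟨ ^-homo-* z (suc q) (suc q) ⟩
          z ^ suc q * z ^ suc q     ≈⟨ *-cong z^q≈b z^q≈b ⟩
          b * b                     ∎
        0≤z = 1≤⇒0≤ 1≤z
        upper : E * D ≤ z * (b * b)
        upper = begin
          E * D                       ≤⟨ *-mono-≤ 0≤D (^-nonneg (suc p′) 0≤z)
                                           (rpow≤root^ q 1≤z z^q≈b (suc p′) ≤p′)
                                               (rpow≤root^ q 1≤z z^q≈b (suc p) (<⇒≤ Qx<p+1)) ⟩
          z ^ suc p′ * (z * z ^ p)    ≈⟨ solve 3 (λ z u v → v :* (z :* u) := z :* (u :* v)) refl z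
              (z ^ p) (z ^ suc p′) ⟩
          z * (z ^ p * z ^ suc p′)    ≈⟨ *-congˡ z^ ⟩
          z * (b * b)                 ∎
        lower : b * b ≤ z * (E * D)
        lower = begin
          b * b                    ≈⟨ z^ ⟨
          z ^ p * (z * z ^ p′)     ≈⟨ solve 3 (λ z u v → u :* (z :* v) := z :* (v :* u)) refl z (z ^ p)
              (z ^ p′) ⟩
          z * (z ^ p′ * z ^ p)     ≤⟨ *-monoˡ-≤ 0≤z (*-mono-≤ (^-nonneg p 0≤z) 0≤E
                                       (root^≤rpow q 1≤z z^q≈b p′ p′≤) (root^≤rpow q 1≤z z^q≈b p p≤Qx)) ⟩
          z * (E * D)              ∎

  ^ʳ-complement : ∀ {δ} → 0# ≤ δ → δ ≤ 1# → ∀ N .{{_ : NonZero N}} →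
    N ^ʳ (2# - δ) * N ^ʳ δ ≈ fromℕ N * fromℕ N
  ^ʳ-complement 0≤δ δ≤1 N = rpow-complement (1≤fromℕ N) 0≤δ δ≤1

  1≤^ʳ : ∀ {δ} → 0# ≤ δ → ∀ N .{{_ : NonZero N}} → 1# ≤ N ^ʳ δ
  1≤^ʳ 0≤δ N = 1≤rpow (1≤fromℕ N) 0≤δ

  reciprocal-≤ : ∀ {δ} → 0# < δ → ∃[ q ] 1# ≤ fromℕ (suc q) * δ
  reciprocal-≤ {δ} 0<δ = let q , h = archimedean-multiple 1# 0<δ in q , <⇒≤ h

  root≥ : ∀ q M {N z} → 1# ≤ z → z ^ suc q ≈ fromℕ N → M ℕ.^ suc q ℕ.≤ N → fromℕ M ≤ z
  root≥ q M {N} {z} 1≤z z^q≈N M^q≤N = ^-cancelˡ-≤ q 1≤z (begin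
    fromℕ M ^ suc q       ≈⟨ fromℕ-^ M (suc q) ⟨
    fromℕ (M ℕ.^ suc q)   ≤⟨ fromℕ-mono-≤ M^q≤N ⟩
    fromℕ N               ≈⟨ z^q≈N ⟨
    z ^ suc q             ∎)
    where open ≤-R

  -- If `1/(q+1) ≤ δ`, then `N^δ` is at least the root of `N` of order `q + 1`, which reaches `M`
  -- once `N ≥ M^(q+1)`.
  ^ʳ-unbounded : ∀ {δ} → 0# < δ → ∀ M →
    ∃[ N₀ ] (∀ N .{{_ : NonZero N}} → N₀ ℕ.≤ N → fromℕ M ≤ N ^ʳ δ)
  ^ʳ-unbounded {δ} 0<δ M = M ℕ.^ suc q , bound
    where
    q = proj₁ (reciprocal-≤ 0<δ)
    1≤qδ = proj₂ (reciprocal-≤ 0<δ)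
    bound : ∀ N .{{_ : NonZero N}} → M ℕ.^ suc q ℕ.≤ N → fromℕ M ≤ N ^ʳ δ
    bound N M^q≤N = let z , 1≤z , z^q≈N = root q (1≤fromℕ N) in ≤-trans (root≥ q M {N} 1≤z z^q≈N M^q≤N)
      (≤-respˡ-≈ (*-identityʳ z) (root^≤rpow (1≤fromℕ N) q 1≤z z^q≈N 1
        (≤-respˡ-≈ (sym (+-identityʳ 1#)) 1≤qδ)))

  -- If `1/(q+1) ≤ 1 - δ`, then `N^δ ≤ z^q` for the root `z` of order `q + 1`, and `N = z^(q+1)` has
  -- one further factor `z`, which is at least `M`.
  ^ʳ-sublinear : ∀ {δ} → δ < 1# → ∀ M →
    ∃[ N₀ ] (∀ N .{{_ : NonZero N}} → N₀ ℕ.≤ N → fromℕ M * N ^ʳ δ ≤ fromℕ N)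
  ^ʳ-sublinear {δ} δ<1 M = M ℕ.^ suc q , bound
    where
    open ≤-R
    q = proj₁ (reciprocal-≤ (<⇒0<- δ<1))
    1≤q[1-δ] = proj₂ (reciprocal-≤ (<⇒0<- δ<1))
    Qδ≤q : fromℕ (suc q) * δ ≤ fromℕ q
    Qδ≤q = ≤-by (≤⇒0≤- 1≤q[1-δ])
        (solve 2 (λ q δ → q :- (:1 :+ q) :* δ := (:1 :+ q) :* (:1 :- δ) :- :1) refl (fromℕ q) δ)
    bound : ∀ N .{{_ : NonZero N}} → M ℕ.^ suc q ℕ.≤ N → fromℕ M * N ^ʳ δ ≤ fromℕ N
    bound N M^q≤N = let z , 1≤z , z^q≈N = root q (1≤fromℕ N) in begin
      fromℕ M * N ^ʳ δ    ≤⟨ *-monoˡ-≤ (0≤fromℕ M) (rpow≤root^ (1≤fromℕ N) q 1≤z z^q≈N q Qδ≤q) ⟩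
      fromℕ M * z ^ q     ≤⟨ *-monoʳ-≤ (^-nonneg q (1≤⇒0≤ 1≤z)) (root≥ q M {N} 1≤z z^q≈N M^q≤N) ⟩
      z ^ suc q           ≈⟨ z^q≈N ⟩
      fromℕ N             ∎

  -- Distance to the nearest integer

  ∣∣≤ : ∀ {x r} → x ≤ r → - x ≤ r → ∣ x ∣ ≤ r
  ∣∣≤ {x} = NaturalMax.⊔-lub totalOrder

  x≤∣x∣ : ∀ x → x ≤ ∣ x ∣
  x≤∣x∣ x = NaturalMax.x≤x⊔y totalOrder x (- x)

  -x≤∣x∣ : ∀ x → - x ≤ ∣ x ∣
  -x≤∣x∣ x = NaturalMax.x≤y⊔x totalOrder x (- x)

  fromℤ-mono-≤ : ∀ {i j} → i ℤ.≤ j → fromℤ i ≤ fromℤ j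
  fromℤ-mono-≤ (ℤ.-≤- n≤m)        = neg-mono-≤ (fromℕ-mono-≤ (s≤s n≤m))
  fromℤ-mono-≤ (ℤ.-≤+ {m} {n})    = ≤-trans (neg-mono-≤ (0≤fromℕ (suc m)))
    (≤-respˡ-≈ (solve 0 (con (+ 0) := :- con (+ 0)) refl) (0≤fromℕ n))
  fromℤ-mono-≤ (ℤ.+≤+ m≤n)        = fromℕ-mono-≤ m≤n

  1+fromℤ : ∀ k → fromℤ (ℤ.suc k) ≈ 1# + fromℤ k
  1+fromℤ k = trans (fromℤ-+ (+ 1) k) (+-congʳ (+-identityʳ 1#))

  floorℤ : ∀ x → ∃[ k ] (fromℤ k ≤ x × x ≤ fromℤ (ℤ.suc k))
  floorℤ x = + m ℤ.- + n , lower , upper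
    where
    open ≤-R
    n = proj₁ (archimedean (- x))
    0≤x+n : 0# ≤ x + fromℕ n
    0≤x+n = ≤-respʳ-≈ (solve 2 (λ x n → n :- :- x := x :+ n) refl x (fromℕ n))
        (≤⇒0≤- (proj₂ (archimedean (- x))))
    ⌊x+n⌋ = floor 0≤x+n
    m = proj₁ ⌊x+n⌋
    m-n : fromℤ (+ m ℤ.- + n) ≈ fromℕ m - fromℕ n
    m-n = trans (fromℤ-+ (+ m) (ℤ.- + n)) (+-congˡ (fromℤ-neg (+ n)))
    lower : fromℤ (+ m ℤ.- + n) ≤ x
    lower = ≤-respˡ-≈ (sym m-n) (≤-by (≤⇒0≤- (proj₁ (proj₂ ⌊x+n⌋)))
      (solve 3 (λ x m n → x :- (m :- n) := x :+ n :- m) refl x (fromℕ m) (fromℕ n)))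
    upper : x ≤ fromℤ (ℤ.suc (+ m ℤ.- + n))
    upper = ≤-respʳ-≈ (sym (trans (1+fromℤ (+ m ℤ.- + n)) (+-congˡ m-n)))
      (≤-by (≤⇒0≤- (<⇒≤ (proj₂ (proj₂ ⌊x+n⌋))))
        (solve 3 (λ x m n → :1 :+ (m :- n) :- x := (:1 :+ m) :- (x :+ n)) refl x (fromℕ m) (fromℕ n)))

  infix 4 _≤ᶻ_
  -- A form of `‖ x ‖ ≤ r` with an explicit integer. The norm is an infimum, so producing this
  -- integer requires showing that the infimum is attained.
  _≤ᶻ_ : Carrier → Carrier → Set
  x ≤ᶻ r = ∃[ k ] (x - fromℤ k ≤ r × fromℤ k - x ≤ r)

  ≤ᶻ⇒‖‖≤ : ∀ {x r} → x ≤ᶻ r → ‖ x ‖ ≤ r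
  ≤ᶻ⇒‖‖≤ {x} (k , upper , lower) = ≤-trans
    (sup-least (proj₂ (‖‖-sup x)) (λ lb → lb (k , refl)))
    (∣∣≤ upper (≤-respˡ-≈ (solve 2 (λ x k → k :- x := :- (x :- k)) refl x (fromℤ k)) lower))

  -- No integer lies strictly between `⌊x⌋` and `⌊x⌋ + 1`, so the smaller of the distances to these
  -- two is a lower bound for all distances to integers. `‖ x ‖` is the supremum of such bounds and
  -- hence at least this distance.
  ‖‖≤⇒≤ᶻ : ∀ {x r} → ‖ x ‖ ≤ r → x ≤ᶻ r
  ‖‖≤⇒≤ᶻ {x} {r} ‖x‖≤r = nearest (total (x - fromℤ k) (fromℤ (ℤ.suc k) - x))
    where
    open ≤-R
    k = proj₁ (floorℤ x)
    k≤x = proj₁ (proj₂ (floorℤ x))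
    x≤k+1 = proj₂ (proj₂ (floorℤ x))
    lowerBound : ∀ {d} → d ≤ x - fromℤ k → d ≤ fromℤ (ℤ.suc k) - x → d ≤ ‖ x ‖
    lowerBound {d} d≤x-k d≤k+1-x = proj₁
        (proj₂ (‖‖-sup x)) λ { (j , e) → ≤-respʳ-≈ (sym e) (bound j (ℤ.<-cmp k j)) }
      where
      bound′ : ∀ j → j ℤ.≤ k → d ≤ ∣ x - fromℤ j ∣
      bound′ j j≤k = begin
        d               ≤⟨ d≤x-k ⟩
        x - fromℤ k     ≤⟨ +-mono-≤ ≤-refl (neg-mono-≤ (fromℤ-mono-≤ j≤k)) ⟩
        x - fromℤ j     ≤⟨ x≤∣x∣ _ ⟩
        ∣ x - fromℤ j ∣ ∎
      bound : ∀ j → Tri (k ℤ.< j) (k ≡ j) (j ℤ.< k) → d ≤ ∣ x - fromℤ j ∣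
      bound j (tri≈ _ k≡j _) = bound′ j (ℤ.≤-reflexive (≡.sym k≡j))
      bound j (tri> _ _ j<k) = bound′ j (ℤ.<⇒≤ j<k)
      bound j (tri< k<j _ _) = begin
        d                      ≤⟨ d≤k+1-x ⟩
        fromℤ (ℤ.suc k) - x    ≤⟨ +-monoˡ-≤ _ (fromℤ-mono-≤ (ℤ.i<j⇒suc[i]≤j k<j)) ⟩
        fromℤ j - x            ≈⟨ solve 2 (λ x j → j :- x := :- (x :- j)) refl x (fromℤ j) ⟩
        - (x - fromℤ j)        ≤⟨ -x≤∣x∣ _ ⟩
        ∣ x - fromℤ j ∣        ∎
    nearest : (x - fromℤ k ≤ fromℤ (ℤ.suc k) - x) ⊎ (fromℤ (ℤ.suc k) - x ≤ x - fromℤ k) → x ≤ᶻ r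
    nearest (inj₁ h) = k , x-k≤r ,
      ≤-trans (≤-by (≤⇒0≤- k≤x ⊕ ≤⇒0≤- k≤x)
          (solve 2 (λ x k → (x :- k) :- (k :- x) := (x :- k) :+ (x :- k)) refl x (fromℤ k))) x-k≤r
      where x-k≤r = ≤-trans (lowerBound ≤-refl h) ‖x‖≤r
    nearest (inj₂ h) = ℤ.suc k ,
      ≤-trans (≤-by (≤⇒0≤- x≤k+1 ⊕ ≤⇒0≤- x≤k+1)
          (solve 2 (λ x k → (k :- x) :- (x :- k) := (k :- x) :+ (k :- x)) refl x (fromℤ (ℤ.suc k)))) k+1-x≤r
      , k+1-x≤r
      where k+1-x≤r = ≤-trans (lowerBound h ≤-refl) ‖x‖≤r

  ‖‖≤-shift : ∀ {x y r} k → y ≈ x + fromℤ k → ‖ x ‖ ≤ r → ‖ y ‖ ≤ r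
  ‖‖≤-shift {x} {y} {r} k y≈x+k ‖x‖≤r = let j , upper , lower = ‖‖≤⇒≤ᶻ ‖x‖≤r in
    ≤ᶻ⇒‖‖≤ (j ℤ.+ k ,
      ≤-respˡ-≈ (begin-equality
        x - fromℤ j                      ≈⟨ solve 3 (λ x j k → x :- j := x :+ k :- (j :+ k)) refl x
            (fromℤ j) (fromℤ k) ⟩
        x + fromℤ k - (fromℤ j + fromℤ k) ≈⟨ +-cong y≈x+k (-‿cong (fromℤ-+ j k)) ⟨
        y - fromℤ (j ℤ.+ k)              ∎) upper ,
      ≤-respˡ-≈ (begin-equality
        fromℤ j - x                      ≈⟨ solve 3 (λ x j k → j :- x := j :+ k :- (x :+ k)) refl x
            (fromℤ j) (fromℤ k) ⟩
        fromℤ j + fromℤ k - (x + fromℤ k) ≈⟨ +-cong (fromℤ-+ j k) (-‿cong y≈x+k) ⟨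
        fromℤ (j ℤ.+ k) - y              ∎) lower)
    where open ≤-R

  ‖‖≤-cong : ∀ {x y r} → x ≈ y → ‖ x ‖ ≤ r → ‖ y ‖ ≤ r
  ‖‖≤-cong x≈y = ‖‖≤-shift (+ 0) (trans (sym x≈y) (sym (+-identityʳ _)))

  ‖‖≤-neg : ∀ {x y r} → y ≈ - x → ‖ x ‖ ≤ r → ‖ y ‖ ≤ r
  ‖‖≤-neg {x} {y} {r} y≈-x ‖x‖≤r = let j , upper , lower = ‖‖≤⇒≤ᶻ ‖x‖≤r in
    ≤ᶻ⇒‖‖≤ (ℤ.- j ,
      ≤-respˡ-≈ (begin-equality
        fromℤ j - x               ≈⟨ solve 2 (λ x j → j :- x := :- x :- :- j) refl x (fromℤ j) ⟩
        - x - (- fromℤ j)         ≈⟨ +-cong y≈-x (-‿cong (fromℤ-neg j)) ⟨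
        y - fromℤ (ℤ.- j)         ∎) lower ,
      ≤-respˡ-≈ (begin-equality
        x - fromℤ j               ≈⟨ solve 2 (λ x j → x :- j := :- j :- :- x) refl x (fromℤ j) ⟩
        - fromℤ j - (- x)         ≈⟨ +-cong (fromℤ-neg j) (-‿cong y≈-x) ⟨
        fromℤ (ℤ.- j) - y         ∎) upper)
    where open ≤-R

  ‖‖≤⇒near-0-or-1 : ∀ {x r} → ‖ x ‖ ≤ r → x ≤ r ⊎ 1# - x ≤ r
  ‖‖≤⇒near-0-or-1 {x} {r} ‖x‖≤r = alt (‖‖≤⇒≤ᶻ ‖x‖≤r)
    where
    open ≤-R
    left : ∀ k → k ℤ.≤ + 0 → x - fromℤ k ≤ r → x ≤ r
    left k k≤0 upper = ≤-trans
        (≤-by (≤⇒0≤- (fromℤ-mono-≤ k≤0))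
            (solve 2 (λ x k → x :- k :- x := con (+ 0) :- k) refl x (fromℤ k))) upper
    alt : x ≤ᶻ r → x ≤ r ⊎ 1# - x ≤ r
    alt (k , upper , lower) with ℤ.<-cmp (+ 0) k
    ... | tri≈ _ 0≡k _ = inj₁ (left k (ℤ.≤-reflexive (≡.sym 0≡k)) upper)
    ... | tri> _ _ k<0 = inj₁ (left k (ℤ.<⇒≤ k<0) upper)
    ... | tri< 0<k _ _ = inj₂ (≤-trans (+-monoˡ-≤ (- x)
      (≤-respˡ-≈ (+-identityʳ 1#) (fromℤ-mono-≤ (ℤ.i<j⇒suc[i]≤j 0<k)))) lower)

  0≤x≤2r⇒‖x-r‖≤r : ∀ {x r} → 0# ≤ x → x ≤ r + r → ‖ x - r ‖ ≤ r
  0≤x≤2r⇒‖x-r‖≤r {x} {r} 0≤x x≤2r = ≤ᶻ⇒‖‖≤ (+ 0 ,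
    ≤-by (≤⇒0≤- x≤2r) (solve 2 (λ x r → r :- (x :- r :- con (+ 0)) := r :+ r :- x) refl x r) ,
    ≤-by 0≤x (solve 2 (λ x r → r :- (con (+ 0) :- (x :- r)) := x) refl x r))

  -- The arc of radius `r` about `r` starts at 0; `x < 1` excludes points that reach it by wrapping
  -- around.
  ‖x-r‖≤r⇒x≤2r : ∀ {x r} → x < 1# → ‖ x - r ‖ ≤ r → x ≤ r + r
  ‖x-r‖≤r⇒x≤2r {x} {r} x<1 h = [ left , right ]′ (‖‖≤⇒near-0-or-1 h)
    where
    left : x - r ≤ r → x ≤ r + r
    left x-r≤r = ≤-by (≤⇒0≤- x-r≤r) (solve 2 (λ x r → r :+ r :- x := r :- (x :- r)) refl x r)
    right : 1# - (x - r) ≤ r → x ≤ r + r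
    right 1-x+r≤r = contradiction
      (≤-by (≤⇒0≤- 1-x+r≤r) (solve 2 (λ x r → x :- :1 := r :- (:1 :- (x :- r))) refl x r)) (<⇒≱ x<1)

  ceiling : ∀ {x} → 0# ≤ x → ∃[ n ] (x ≤ fromℕ n × fromℕ n < x + 1#)
  ceiling {x} 0≤x = let n , n≤x , x<n+1 = floor 0≤x in up n n≤x x<n+1
    where
    up : ∀ n → fromℕ n ≤ x → x < fromℕ (suc n) → ∃[ n ] (x ≤ fromℕ n × fromℕ n < x + 1#)
    up n n≤x x<n+1 with x ≤? fromℕ n
    ... | yes x≤n = n , x≤n , ≤-<-trans n≤x
        (0<-⇒< (<-≤-trans 0<1 (≤-reflexive (solve 1 (λ x → :1 := x :+ :1 :- x) refl x))))
    ... | no  x≰n = suc n , <⇒≤ x<n+1 , 0<-⇒< (<-≤-trans (<⇒0<- (≰⇒> x≰n)) (≤-reflexive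
      (solve 2 (λ x n → x :- n := x :+ :1 :- (:1 :+ n)) refl x (fromℕ n))))

  -- Points of an arithmetic progression of step 1/K in an arc of length 2r

  module _ (K : ℕ) .{{_ : NonZero K}} {r} (0≤r : 0# ≤ r) (2r<1 : r + r < 1#)
           {n} (n≤w : fromℕ n ≤ (r + r) * fromℕ K) (w<n+1 : (r + r) * fromℕ K < fromℕ (suc n)) where

    private
      open ≤-R
      κ = fromℕ K ⁻¹
      0<K : 0# < fromℕ K
      0<K = 1≤⇒0< (1≤fromℕ K)
      Kκ : fromℕ K * κ ≈ 1#
      Kκ = ⁻¹-inverseʳ⁺ 0<K
      module _ (t : Carrier) where
        hit : Carrier → ℕ → ℕ
        hit θ i = ⟦ ‖ (fromℕ i + θ) / fromℕ K - t ‖ ≤? r ⟧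

        hit-cong : ∀ {θ θ′ i i′} m → fromℕ i + θ ≈ fromℕ i′ + θ′ + fromℕ m * fromℕ K → hit θ i ≡ hit θ′ i′
        hit-cong {θ} {θ′} {i} {i′} m e = ⟦⟧-cong (_ ≤? r) (_ ≤? r)
          (‖‖≤-shift (ℤ.- + m) (trans
              (trans (solve 3 (λ a t m → a :- t := a :+ m :- t :- m) refl (a′ * κ) t (fromℕ m))
                                    (+-congʳ (+-congʳ (sym e′)))) (+-congˡ (sym (fromℤ-neg (+ m))))))
          (‖‖≤-shift (+ m) (trans (+-congʳ e′)
              (solve 3 (λ a t m → a :+ m :- t := a :- t :+ m) refl (a′ * κ) t (fromℕ m))))
          where
          a′ = fromℕ i′ + θ′
          e′ : (fromℕ i + θ) * κ ≈ a′ * κ + fromℕ m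
          e′ = begin-equality
            (fromℕ i + θ) * κ                 ≈⟨ *-congʳ e ⟩
            (a′ + fromℕ m * fromℕ K) * κ      ≈⟨ solve 4
                (λ a m K κ → (a :+ m :* K) :* κ := a :* κ :+ m :* (K :* κ)) refl a′ (fromℕ m) (fromℕ K) κ ⟩
            a′ * κ + fromℕ m * (fromℕ K * κ)  ≈⟨ +-congˡ (trans (*-congˡ Kκ) (*-identityʳ _)) ⟩
            a′ * κ + fromℕ m                  ∎

        -- Moving the window of `K` points by one step drops `θ/K` and gains `(K + θ)/K`, the same
        -- point modulo 1.
        hits-periodic : ∀ θ → ∑ K (hit θ) ≡ ∑ K (hit (1# + θ))
        hits-periodic θ = ℕ.+-cancelʳ-≡ (hit θ K) _ _ (≡.trans (∑-head K (hit θ))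
          (≡.trans (ℕ.+-comm (hit θ 0) _) (≡.cong₂ ℕ._+_
            (∑-cong K (λ i → hit-cong {θ} {1# + θ} {suc i} {i} 0
              (solve 3 (λ i θ K → :1 :+ i :+ θ := i :+ (:1 :+ θ) :+ con (+ 0) :* K) refl (fromℕ i) θ
                  (fromℕ K))))
            (≡.sym (hit-cong {θ} {θ} {K} {0} 1
              (solve 2 (λ θ K → K :+ θ := con (+ 0) :+ θ :+ (:1 :+ con (+ 0)) :* K) refl θ (fromℕ K)))))))

        hits-shift : ∀ c θ → ∑ K (hit θ) ≡ ∑ K (hit (fromℕ c + θ))
        hits-shift zero    θ = ∑-cong K (λ i → hit-cong {θ} {0# + θ} {i} {i} 0
          (solve 3 (λ i θ K → i :+ θ := i :+ (con (+ 0) :+ θ) :+ con (+ 0) :* K) refl (fromℕ i) θ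
              (fromℕ K)))
        hits-shift (suc c) θ = ≡.trans (hits-shift c θ) (≡.trans (hits-periodic (fromℕ c + θ))
          (∑-cong K (λ i → hit-cong {1# + (fromℕ c + θ)} {fromℕ (suc c) + θ} {i} {i} 0
            (solve 4 (λ i θ c K → i :+ (:1 :+ (c :+ θ)) := i :+ (:1 :+ c :+ θ) :+ con (+ 0) :* K) refl
                (fromℕ i) θ (fromℕ c) (fromℕ K)))))

        -- Up to the integer j, which makes X non-negative, c + θ is the first point of
        -- θ + ℕ at or after K (t - r), and o is its distance from there.
        module _ (θ : Carrier) where
          j : ℕ
          j = proj₁ (archimedean (r - t + θ * κ))
          X : Carrier
          X = fromℕ K * (t + fromℕ j - r) - θ
          X≈ : X ≈ (fromℕ j - (r - t + θ * κ)) * fromℕ K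
          X≈ = begin-equality
            fromℕ K * (t + fromℕ j - r) - θ
              ≈⟨ +-congˡ (-‿cong (trans (sym (*-identityʳ θ)) (*-congˡ (sym Kκ)))) ⟩
            fromℕ K * (t + fromℕ j - r) - θ * (fromℕ K * κ)
              ≈⟨ solve 6 (λ K κ t j r θ → K :* (t :+ j :- r) :- θ :* (K :* κ) :=
                  (j :- (r :- t :+ θ :* κ)) :* K)
                   refl (fromℕ K) κ t (fromℕ j) r θ ⟩
            (fromℕ j - (r - t + θ * κ)) * fromℕ K ∎
          0≤X : 0# ≤ X
          0≤X = ≤-respʳ-≈ (sym X≈) (≤⇒0≤- (proj₂ (archimedean (r - t + θ * κ))) ⊗ 0≤fromℕ K)
          c : ℕ
          c = proj₁ (ceiling 0≤X)
          o : Carrier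
          o = fromℕ c - X
          0≤o : 0# ≤ o
          0≤o = ≤⇒0≤- (proj₁ (proj₂ (ceiling 0≤X)))
          o<1 : o < 1#
          o<1 = 0<-⇒< (<-≤-trans (<⇒0<- (proj₂ (proj₂ (ceiling 0≤X))))
            (≤-reflexive (solve 2 (λ x n → x :+ :1 :- n := :1 :- (n :- x)) refl X (fromℕ c))))

          -- Modulo 1, point `i` of the window lies `(i + o)/K` beyond the start `t - r` of the arc.
          -- For `i < K` this is less than 1, so membership in the arc becomes the single inequality
          -- `i + o ≤ 2rK`.
          offset : ∀ i → (fromℕ i + (fromℕ c + θ)) * κ - t ≈ (fromℕ i + o) * κ - r + fromℕ j
          offset i = sym (begin-equality
            (fromℕ i + (fromℕ c - (fromℕ K * (t + fromℕ j - r) - θ))) * κ - r + fromℕ j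
              ≈⟨ solve 8 (λ i c K t j r θ κ → (i :+ (c :- (K :* (t :+ j :- r) :- θ))) :* κ :- r :+ j
                          := (i :+ (c :+ θ)) :* κ :- (K :* κ) :* (t :+ j :- r) :- r :+ j)
                   refl (fromℕ i) (fromℕ c) (fromℕ K) t (fromℕ j) r θ κ ⟩
            (fromℕ i + (fromℕ c + θ)) * κ - (fromℕ K * κ) * (t + fromℕ j - r) - r + fromℕ j
              ≈⟨ +-congʳ (+-congʳ (+-congˡ (-‿cong (*-congʳ Kκ)))) ⟩
            (fromℕ i + (fromℕ c + θ)) * κ - 1# * (t + fromℕ j - r) - r + fromℕ j
              ≈⟨ solve 4 (λ a t j r → a :- :1 :* (t :+ j :- r) :- r :+ j := a :- t) refl
                  ((fromℕ i + (fromℕ c + θ)) * κ) t (fromℕ j) r ⟩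
            (fromℕ i + (fromℕ c + θ)) * κ - t ∎)

          *K : ∀ x → x * κ * fromℕ K ≈ x
          *K x = trans (*-assoc x κ (fromℕ K))
              (trans (*-congˡ (trans (*-comm κ (fromℕ K)) Kκ)) (*-identityʳ x))

          near : ∀ i → fromℕ i + o ≤ (r + r) * fromℕ K → ‖ (fromℕ i + (fromℕ c + θ)) * κ - t ‖ ≤ r
          near i h = ‖‖≤-shift (+ j) (offset i) (0≤x≤2r⇒‖x-r‖≤r ((0≤fromℕ i ⊕ 0≤o) ⊗ ⁻¹-nonneg 0<K)
            (*-cancelʳ-≤ 0<K (≤-respˡ-≈ (sym (*K _)) h)))

          near⁻ : ∀ {i} → i ℕ.< K → ‖ (fromℕ i + (fromℕ c + θ)) * κ - t ‖ ≤ r → fromℕ i + o ≤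
              (r + r) * fromℕ K
          near⁻ {i} i<K h = ≤-respˡ-≈ (*K _) (*-monoʳ-≤ (<⇒≤ 0<K) (‖x-r‖≤r⇒x≤2r
            (*-cancelʳ-< (<⇒≤ 0<K) (begin-strict
              (fromℕ i + o) * κ * fromℕ K  ≈⟨ *K _ ⟩
              fromℕ i + o                  <⟨ 0<-⇒<
                  (<-≤-trans (<⇒0<- o<1) (≤-reflexive
                      (solve 2 (λ i o → :1 :- o := (:1 :+ i) :- (i :+ o)) refl (fromℕ i) o))) ⟩
              fromℕ (suc i)                ≤⟨ fromℕ-mono-≤ i<K ⟩
              fromℕ K                      ≈⟨ *-identityˡ _ ⟨
              1# * fromℕ K                 ∎))
            (‖‖≤-shift (ℤ.- + j) (trans (solve 2 (λ a j → a := a :+ j :- j) refl _ (fromℕ j))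
               (+-cong (sym (offset i)) (sym (fromℤ-neg (+ j))))) h)))

          hits≤ : ∑ K (hit (fromℕ c + θ)) ℕ.≤ suc n
          hits≤ = ℕ.≤-trans (∑-mono K (λ {i} i<K → ⟦⟧-mono (_ ≤? r) (i ℕ.<? suc n) (λ h →
            s≤s (i≤n i (≤-<-trans (≤-trans (≤-respˡ-≈ (+-identityʳ _) (+-mono-≤ ≤-refl 0≤o))
                (near⁻ i<K h)) w<n+1)))))
            (∑-<-indicator K (suc n))
            where
            i≤n : ∀ i → fromℕ i < fromℕ (suc n) → i ℕ.≤ n
            i≤n i h with i ℕ.≤? n
            ... | yes p = p
            ... | no  p = contradiction (fromℕ-mono-≤ (ℕ.≰⇒> p)) (<⇒≱ h)

          ≤hits : n ℕ.≤ ∑ K (hit (fromℕ c + θ))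
          ≤hits = ℕ.≤-trans (ℕ.≤-trans (ℕ.≤-reflexive (≡.sym (ℕ.*-identityʳ n))) (n*c≤∑ n 1 (λ {i} i<n →
              ℕ.≤-reflexive (≡.sym (⟦⟧≡1 (_ ≤? r) (near i (begin
                fromℕ i + o          ≤⟨ +-mono-≤ ≤-refl (<⇒≤ o<1) ⟩
                fromℕ i + 1#         ≈⟨ +-comm _ _ ⟩
                fromℕ (suc i)        ≤⟨ fromℕ-mono-≤ i<n ⟩
                fromℕ n              ≤⟨ n≤w ⟩
                (r + r) * fromℕ K    ∎)))))))
            -- The first `n` points are among the `K` counted: `n ≤ 2rK ≤ K`.
            (∑-monoˡ (hit (fromℕ c + θ))
                (fromℕ-cancel-≤ {n} {K} (≤-trans n≤w
                    (≤-respʳ-≈ (*-identityˡ _) (*-monoʳ-≤ (<⇒≤ 0<K) (<⇒≤ 2r<1))))))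

    arc-count : ∀ t θ →
      let count = ∑ K (λ i → ⟦ ‖ (fromℕ i + θ) / fromℕ K - t ‖ ≤? r ⟧)
      in n ℕ.≤ count × count ℕ.≤ suc n
    arc-count t θ = ≡.subst (λ m → n ℕ.≤ m × m ℕ.≤ suc n) (≡.sym (hits-shift t (c t θ) θ))
        (≤hits t θ , hits≤ t θ)

  -- The van der Corput sequence

  -- Reverses the binary digits of i about the binary point, for i ≤ fuel.
  radicalInverse : (fuel i : ℕ) → Carrier
  radicalInverse zero       i = 0#
  radicalInverse (suc fuel) i = (fromℕ (i ℕ.% 2) + radicalInverse fuel (i ℕ./ 2)) / 2#

  radicalInverse-0 : ∀ f → radicalInverse f 0 ≈ 0#
  radicalInverse-0 zero    = refl
  radicalInverse-0 (suc f) = trans (*-congʳ (trans (+-identityˡ _) (radicalInverse-0 f))) (zeroˡ _)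

  -- Each step halves the index but lowers the fuel only by one, so smaller indices appear with
  -- surplus fuel. The surplus only adds zero digits.
  radicalInverse-fuel : ∀ {f g i} → i ℕ.≤ f → i ℕ.≤ g → radicalInverse f i ≈ radicalInverse g i
  radicalInverse-fuel {zero}  {g}     z≤n _   = sym (radicalInverse-0 g)
  radicalInverse-fuel {suc f} {zero}  _   z≤n = radicalInverse-0 (suc f)
  radicalInverse-fuel {suc f} {suc g} {i} i≤f i≤g =
    *-congʳ (+-congˡ (radicalInverse-fuel (half i i≤f) (half i i≤g)))
    where
    half : ∀ {f} i → i ℕ.≤ suc f → i ℕ./ 2 ℕ.≤ f
    half zero    _     = z≤n
    half (suc i) i<1+f = ℕ.s≤s⁻¹ (ℕ.≤-trans (m/n<m (suc i) 2 (s≤s (s≤s z≤n))) i<1+f)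

  corput : ℕ → Carrier
  corput i = radicalInverse i i

  corput-digit : ∀ {b} j → b ℕ.< 2 → corput (b ℕ.+ j ℕ.* 2) ≈ (fromℕ b + corput j) / 2#
  corput-digit {b} j b<2 = begin-equality
    corput i                          ≈⟨ radicalInverse-fuel ℕ.≤-refl (ℕ.n≤1+n i) ⟩
    radicalInverse (suc i) i          ≡⟨ ≡.cong₂
        (λ b′ j′ → (fromℕ b′ + radicalInverse i j′) / 2#) i%2≡b i/2≡j ⟩
    (fromℕ b + radicalInverse i j) / 2#  ≈⟨ *-congʳ (+-congˡ (radicalInverse-fuel j≤i ℕ.≤-refl)) ⟩
    (fromℕ b + corput j) / 2#         ∎
    where
    open ≤-R
    i = b ℕ.+ j ℕ.* 2
    i%2≡b : i ℕ.% 2 ≡ b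
    i%2≡b = ≡.trans ([m+kn]%n≡m%n b j 2) (m<n⇒m%n≡m b<2)
    i/2≡j : i ℕ./ 2 ≡ j
    i/2≡j = ℕ.*-cancelʳ-≡ (i ℕ./ 2) j 2 (ℕ.+-cancelˡ-≡ b _ _
      (≡.trans (≡.cong (ℕ._+ i ℕ./ 2 ℕ.* 2) (≡.sym i%2≡b)) (≡.sym (m≡m%n+[m/n]*n i 2))))
    j≤i : j ℕ.≤ i
    j≤i = ℕ.≤-trans (ℕ.m≤m*n j 2) (ℕ.m≤n+m _ b)

  module _ (F : Carrier → ℕ) (F-cong : ∀ {x y} → x ≈ y → F x ≡ F y) where

    -- Within a block the low `k` digits of the index take all values and the higher digits are
    -- those of `j`; reversing the low digits permutes `0, …, 2^k - 1`. Summing an arbitrary `F`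
    -- expresses this without naming the permutation. In the induction step the top low digit `b` of
    -- the index joins `j` as `b + 2j` and reappears as the lowest digit of the numerator `b + 2a`.
    ∑-corput-block : ∀ k j → ∑ (2 ℕ.^ k) (λ i → F (corput (i ℕ.+ j ℕ.* 2 ℕ.^ k)))
                           ≡ ∑ (2 ℕ.^ k) (λ a → F ((fromℕ a + corput j) / fromℕ (2 ℕ.^ k)))
    ∑-corput-block zero    j = F-cong (begin-equality
      corput (j ℕ.* 1)                ≡⟨ ≡.cong corput (ℕ.*-identityʳ j) ⟩
      corput j                        ≈⟨ *-identityʳ _ ⟨
      corput j * 1#                   ≈⟨ *-congˡ (⁻¹-inverseʳ⁺ (1≤⇒0< (1≤fromℕ 1))) ⟨
      corput j * (fromℕ 1 / fromℕ 1)  ≈⟨ solve 2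
          (λ x h → x :* ((:1 :+ con (+ 0)) :* h) := (con (+ 0) :+ x) :* h) refl (corput j) (fromℕ 1 ⁻¹) ⟩
      (fromℕ 0 + corput j) / fromℕ 1  ∎)
      where open ≤-R
    ∑-corput-block (suc k) j =
      ≡.trans (∑-blocks 2 K _)
        (≡.trans (∑-cong-< 2 λ {b} b<2 → ≡.trans (∑-cong K λ i → ≡.cong (λ m → F (corput m)) (index i b))
          (≡.trans (∑-corput-block k (b ℕ.+ j ℕ.* 2)) (∑-cong K λ a → F-cong (point a b b<2))))
        (≡.trans (∑-comm 2 K (λ b a → f (b ℕ.+ a ℕ.* 2)))
        (≡.trans (≡.sym (∑-blocks K 2 f))
          (≡.cong (λ n → ∑ n f) (ℕ.*-comm K 2)))))
      where
      open ≤-R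
      K = 2 ℕ.^ k
      instance
        K≢0 : NonZero K
        K≢0 = ℕ.m^n≢0 2 k
        2K≢0 : NonZero (2 ℕ.* K)
        2K≢0 = ℕ.m^n≢0 2 (suc k)
      f : ℕ → ℕ
      f a = F ((fromℕ a + corput j) / fromℕ (2 ℕ.* K))
      index : ∀ i b → i ℕ.+ b ℕ.* K ℕ.+ j ℕ.* (2 ℕ.* K) ≡ i ℕ.+ (b ℕ.+ j ℕ.* 2) ℕ.* K
      index i b = S.solve 4 (λ i b j K → i S.:+ b S.:* K S.:+ j S.:* (S.con 2 S.:* K) S.:= i S.:+
          (b S.:+ j S.:* S.con 2) S.:* K) ≡.refl i b j K
        where module S = +-*-Solver
      h = 2# ⁻¹
      κ = fromℕ K ⁻¹
      ρ = fromℕ (2 ℕ.* K) ⁻¹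
      2h : 2# * h ≈ 1#
      2h = ⁻¹-inverseʳ⁺ (1≤⇒0< (1≤fromℕ 2))
      hκ≈ρ : h * κ ≈ ρ
      hκ≈ρ = begin-equality
        h * κ                             ≈⟨ trans (sym (*-identityʳ _))
            (*-congˡ (sym (⁻¹-inverseʳ⁺ (1≤⇒0< (1≤fromℕ (2 ℕ.* K)))))) ⟩
        h * κ * (fromℕ (2 ℕ.* K) * ρ)     ≈⟨ *-congˡ (*-congʳ (fromℕ-* 2 K)) ⟩
        h * κ * (2# * fromℕ K * ρ)        ≈⟨ solve 5
            (λ h κ t K ρ → h :* κ :* (t :* K :* ρ) := (t :* h) :* (K :* κ) :* ρ) refl h κ 2# (fromℕ K) ρ ⟩
        (2# * h) * (fromℕ K * κ) * ρ      ≈⟨ *-congʳ (*-cong 2h (⁻¹-inverseʳ⁺ (1≤⇒0< (1≤fromℕ K)))) ⟩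
        1# * 1# * ρ                       ≈⟨ solve 1 (λ ρ → :1 :* :1 :* ρ := ρ) refl ρ ⟩
        ρ                                 ∎
      point : ∀ a b → b ℕ.< 2 → (fromℕ a + corput (b ℕ.+ j ℕ.* 2)) * κ ≈
          (fromℕ (b ℕ.+ a ℕ.* 2) + corput j) * ρ
      point a b b<2 = begin-equality
        (fromℕ a + corput (b ℕ.+ j ℕ.* 2)) * κ          ≈⟨ *-congʳ
            (+-cong (trans (sym (*-identityʳ _)) (*-congˡ (sym 2h))) (corput-digit j b<2)) ⟩
        (fromℕ a * (2# * h) + (fromℕ b + corput j) * h) * κ
          ≈⟨ solve 6 (λ a b x t h κ → (a :* (t :* h) :+ (b :+ x) :* h) :* κ := (b :+ a :* t :+ x) :*
              (h :* κ)) refl (fromℕ a) (fromℕ b) (corput j) 2# h κ ⟩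
        (fromℕ b + fromℕ a * 2# + corput j) * (h * κ)   ≈⟨ *-cong
            (+-congʳ (trans (fromℕ-+ b (a ℕ.* 2)) (+-congˡ (fromℕ-* a 2)))) (sym hκ≈ρ) ⟨
        (fromℕ (b ℕ.+ a ℕ.* 2) + corput j) * ρ          ∎

  hits : (ℕ → Carrier) → ℕ → Carrier → Carrier → ℕ
  hits x N r t = ∑ N (λ i → ⟦ ‖ x i - t ‖ ≤? r ⟧)

  -- The first `N` terms contain `q` complete blocks and are covered by `q + 1`; `arc-count` applies
  -- to block `j` with `θ = corput j`. The uniformity in `t` is what later allows arcs centred at
  -- arbitrary, possibly changed, terms.
  corput-hits : ∀ k {r n q N} → 0# ≤ r → r + r < 1# →
    fromℕ n ≤ (r + r) * fromℕ (2 ℕ.^ k) → (r + r) * fromℕ (2 ℕ.^ k) < fromℕ (suc n) →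
    q ℕ.* 2 ℕ.^ k ℕ.≤ N → N ℕ.≤ suc q ℕ.* 2 ℕ.^ k →
    ∀ t → q ℕ.* n ℕ.≤ hits corput N r t × hits corput N r t ℕ.≤ suc q ℕ.* suc n
  corput-hits k {r} {n} {q} {N} 0≤r 2r<1 n≤w w<n+1 qK≤N N≤q+1K t =
    ℕ.≤-trans (ℕ.≤-trans (n*c≤∑ q n (λ {j} _ → proj₁ (block j)))
        (ℕ.≤-reflexive (≡.sym (∑-blocks q K _)))) (∑-monoˡ _ qK≤N) ,
    ℕ.≤-trans (∑-monoˡ _ N≤q+1K)
        (ℕ.≤-trans (ℕ.≤-reflexive (∑-blocks (suc q) K _))
            (∑≤n*c (suc q) (suc n) (λ {j} _ → proj₂ (block j))))
    where
    K = 2 ℕ.^ k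
    instance
      K≢0 : NonZero K
      K≢0 = ℕ.m^n≢0 2 k
    F : Carrier → ℕ
    F x = ⟦ ‖ x - t ‖ ≤? r ⟧
    F-cong : ∀ {x y} → x ≈ y → F x ≡ F y
    F-cong x≈y = ⟦⟧-cong (_ ≤? r) (_ ≤? r) (‖‖≤-cong (+-congʳ x≈y)) (‖‖≤-cong (+-congʳ (sym x≈y)))
    block : ∀ j → n ℕ.≤ ∑ K (λ i → F (corput (i ℕ.+ j ℕ.* K))) × ∑ K
        (λ i → F (corput (i ℕ.+ j ℕ.* K))) ℕ.≤ suc n
    block j = ≡.subst (λ m → n ℕ.≤ m × m ℕ.≤ suc n) (≡.sym (∑-corput-block F F-cong k j))
      (arc-count K 0≤r 2r<1 {n} n≤w w<n+1 t (corput j))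

  -- Pair counts

  -- Pairs are counted over the indices `1, …, N`, whereas the construction starts at 0; the value
  -- at index 0 enters no count.
  fromIndex1 : (ℕ → Carrier) → ℕ → Carrier
  fromIndex1 z zero    = 0#
  fromIndex1 z (suc i) = z i

  close : (ℕ → Carrier) → Carrier → Carrier → ℕ → ℕ → ℕ
  close z γ r i j = ⟦ closePair? (fromIndex1 z) γ r (suc i , suc j) ⟧

  pairCount≡∑ : ∀ z γ r N → pairCount (fromIndex1 z) γ r N ≡ ∑ N (λ i → ∑ N (close z γ r i))
  pairCount≡∑ z γ r N = length-filter-cartesianProduct (closePair? (fromIndex1 z) γ r) suc suc N N

  ≤+1* : ∀ {m b} c {s} → s ≡ 1 → m ℕ.≤ b → m ℕ.≤ c ℕ.+ s ℕ.* b
  ≤+1* {m} {b} c ≡.refl m≤b = ℕ.≤-trans m≤b (ℕ.≤-trans (ℕ.m≤m+n b 0) (ℕ.m≤n+m _ c))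

  -- Modifying a sequence on a set S whose own pairs are never close

  module _ (x z : ℕ → Carrier) {S : ℕ → Set} (S? : ∀ i → Dec (S i))
           (z≈x : ∀ {i} → ¬ S i → z i ≈ x i) {γ r}
           (¬close-0 : ¬ (‖ - γ ‖ ≤ r))
           (¬close-S : ∀ {i j} → S i → S j → ¬ (‖ z i - z j - γ ‖ ≤ r))
           {N L U} (bounds : ∀ t → L ℕ.≤ hits x N r t × hits x N r t ℕ.≤ U) where

    private
      s : ℕ → ℕ
      s i = ⟦ S? i ⟧
      near : Carrier → ℕ → ℕ
      near t i = ⟦ ‖ x i - t ‖ ≤? r ⟧
      P : ℕ → ℕ → ℕ
      P = close z γ r
      T = pairCount (fromIndex1 z) γ r N
      #S = ∑ N s
      forward backward : ℕ → Carrier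
      forward  j = z j + γ
      backward i = z i - γ

      a-b-γ : ∀ {a a′ b} → a ≈ a′ → a - b - γ ≈ a′ - (b + γ)
      a-b-γ {a} {a′} {b} a≈a′ = trans (solve 3 (λ a b γ → a :- b :- γ := a :- (b :+ γ)) refl a b γ)
          (+-congʳ a≈a′)
      b-a+γ : ∀ {a b b′} → b ≈ b′ → b′ - (a - γ) ≈ - (a - b - γ)
      b-a+γ {a} {b} {b′} b≈b′ = trans (+-congʳ (sym b≈b′))
          (solve 3 (λ a b γ → b :- (a :- γ) := :- (a :- b :- γ)) refl a b γ)
      b-a+γ′ : ∀ {a b b′} → b ≈ b′ → b′ - (a - γ) ≈ - (a - (b + γ))
      b-a+γ′ {a} {b} {b′} b≈b′ = trans (+-congʳ (sym b≈b′))
          (solve 3 (λ a b γ → b :- (a :- γ) := :- (a :- (b :+ γ))) refl a b γ)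

    -- If `z i` is unchanged, the pair is charged to the arc about `z j + γ`, one of `N` arcs. If
    -- only `z j` is unchanged, it is charged to the arc about `z i - γ`, and there are `#S` of
    -- these. Two changed terms are never close.
    pairCount-upper : T ℕ.≤ N ℕ.* U ℕ.+ #S ℕ.* U
    pairCount-upper = begin
      T
        ≡⟨ pairCount≡∑ z γ r N ⟩
      ∑ N (λ i → ∑ N (P i))
        ≤⟨ ∑-mono N (λ {i} _ → ∑-mono N (λ {j} _ → pointwise i j (S? i) (S? j))) ⟩
      ∑ N (λ i → ∑ N (λ j → near (forward j) i ℕ.+ s i ℕ.* near (backward i) j))
        ≡⟨ ∑-cong N (λ i → ∑-+ N _ _) ⟩
      ∑ N (λ i → ∑ N (λ j → near (forward j) i) ℕ.+ ∑ N (λ j → s i ℕ.* near (backward i) j))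
        ≡⟨ ∑-+ N _ _ ⟩
      ∑ N (λ i → ∑ N (λ j → near (forward j) i)) ℕ.+ ∑ N (λ i → ∑ N (λ j → s i ℕ.* near (backward i) j))
        ≡⟨ ≡.cong₂ ℕ._+_ (∑-comm N N _) (∑-cong N (λ i → ∑-*ˡ N (near (backward i)) (s i))) ⟩
      ∑ N (λ j → ∑ N (near (forward j))) ℕ.+ ∑ N (λ i → s i ℕ.* ∑ N (near (backward i)))
        ≤⟨ ℕ.+-mono-≤ (∑≤n*c N U (λ {j} _ → proj₂ (bounds (forward j))))
             (∑-mono N (λ {i} _ → ℕ.*-monoʳ-≤ (s i) (proj₂ (bounds (backward i))))) ⟩
      N ℕ.* U ℕ.+ ∑ N (λ i → s i ℕ.* U)
        ≡⟨ ≡.cong (N ℕ.* U ℕ.+_) (∑-*ʳ N s U) ⟩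
      N ℕ.* U ℕ.+ #S ℕ.* U ∎
      where
      open ℕ.≤-Reasoning
      pointwise : ∀ i j → Dec (S i) → Dec (S j) → P i j ℕ.≤ near (forward j) i ℕ.+ s i ℕ.* near
          (backward i) j
      pointwise i j (no ¬Si) _ = ℕ.≤-trans
        (⟦⟧-mono (closePair? (fromIndex1 z) γ r (suc i , suc j)) (_ ≤? r)
            (λ (_ , h) → ‖‖≤-cong (a-b-γ (z≈x ¬Si)) h)) (ℕ.m≤m+n _ _)
      pointwise i j (yes Si) (no ¬Sj) = ≤+1* (near (forward j) i) (⟦⟧≡1 (S? i) Si)
        (⟦⟧-mono (closePair? (fromIndex1 z) γ r (suc i , suc j)) (_ ≤? r)
            (λ (_ , h) → ‖‖≤-neg (b-a+γ (z≈x ¬Sj)) h))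
      pointwise i j (yes Si) (yes Sj) = ℕ.≤-trans
        (⟦⟧-mono (closePair? (fromIndex1 z) γ r (suc i , suc j)) (_ ≤? r)
            (λ (_ , h) → contradiction h (¬close-S Si Sj))) (ℕ.m≤m+n _ _)

    -- The arcs about `z j + γ` catch at least `N L` original terms `x i`. Such a hit is a close
    -- pair of `z` if `i` is outside `S`. Otherwise it is charged to `i` when `j` is outside `S`,
    -- and to `j` when both are in `S`; each kind of charge totals at most `#S U`.
    pairCount-lower : N ℕ.* L ℕ.≤ T ℕ.+ (#S ℕ.* U ℕ.+ #S ℕ.* U)
    pairCount-lower = begin
      N ℕ.* L
        ≤⟨ n*c≤∑ N L (λ {j} _ → proj₁ (bounds (forward j))) ⟩
      ∑ N (λ j → ∑ N (near (forward j)))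
        ≡⟨ ∑-comm N N _ ⟩
      ∑ N (λ i → ∑ N (λ j → near (forward j) i))
        ≤⟨ ∑-mono N (λ {i} _ → ∑-mono N (λ {j} _ → pointwise i j (S? i) (S? j))) ⟩
      ∑ N (λ i → ∑ N (λ j → P i j ℕ.+ (s i ℕ.* near (x i - γ) j ℕ.+ s j ℕ.* near (forward j) i)))
        ≡⟨ ∑-cong N (λ i → ≡.trans (∑-+ N _ _) (≡.cong (∑ N (P i) ℕ.+_) (∑-+ N _ _))) ⟩
      ∑ N (λ i → ∑ N (P i) ℕ.+ (∑ N (λ j → s i ℕ.* near (x i - γ) j) ℕ.+ ∑ N
          (λ j → s j ℕ.* near (forward j) i)))
        ≡⟨ ≡.trans (∑-+ N _ _) (≡.cong (∑ N (λ i → ∑ N (P i)) ℕ.+_) (∑-+ N _ _)) ⟩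
      ∑ N (λ i → ∑ N (P i)) ℕ.+ (∑ N (λ i → ∑ N (λ j → s i ℕ.* near (x i - γ) j)) ℕ.+ ∑ N
          (λ i → ∑ N (λ j → s j ℕ.* near (forward j) i)))
        ≡⟨ ≡.cong₂ ℕ._+_ (≡.sym (pairCount≡∑ z γ r N)) (≡.cong₂ ℕ._+_
             (∑-cong N (λ i → ∑-*ˡ N (near (x i - γ)) (s i)))
             (≡.trans (∑-comm N N _) (∑-cong N (λ j → ∑-*ˡ N (near (forward j)) (s j))))) ⟩
      T ℕ.+ (∑ N (λ i → s i ℕ.* ∑ N (near (x i - γ))) ℕ.+ ∑ N (λ j → s j ℕ.* ∑ N (near (forward j))))
        ≤⟨ ℕ.+-monoʳ-≤ T (ℕ.+-mono-≤ (weighted (λ i → x i - γ)) (weighted forward)) ⟩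
      T ℕ.+ (#S ℕ.* U ℕ.+ #S ℕ.* U) ∎
      where
      open ℕ.≤-Reasoning
      weighted : ∀ t → ∑ N (λ i → s i ℕ.* ∑ N (near (t i))) ℕ.≤ #S ℕ.* U
      weighted t = ℕ.≤-trans (∑-mono N (λ {i} _ → ℕ.*-monoʳ-≤ (s i) (proj₂ (bounds (t i)))))
          (ℕ.≤-reflexive (∑-*ʳ N s U))
      pointwise : ∀ i j → Dec (S i) → Dec (S j) →
        near (forward j) i ℕ.≤ P i j ℕ.+ (s i ℕ.* near (x i - γ) j ℕ.+ s j ℕ.* near (forward j) i)
      pointwise i j (no ¬Si) _ = ℕ.≤-trans
        (⟦⟧-mono (_ ≤? r) (closePair? (fromIndex1 z) γ r (suc i , suc j))
          -- A diagonal hit `i = j` outside `S` would put `-γ` within `r` of an integer.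
          (λ h → (λ { ≡.refl → ¬close-0 (‖‖≤-cong (trans (+-congʳ (sym (z≈x ¬Si)))
                    (solve 2 (λ a γ → a :- (a :+ γ) := :- γ) refl (z i) γ)) h) }) ,
                 ‖‖≤-cong (sym (a-b-γ (z≈x ¬Si))) h))
        (ℕ.m≤m+n _ _)
      pointwise i j (yes Si) (no ¬Sj) = ℕ.≤-trans
        (≤+1* (P i j) (⟦⟧≡1 (S? i) Si) (⟦⟧-mono (_ ≤? r) (_ ≤? r) (λ h → ‖‖≤-neg (b-a+γ′ (z≈x ¬Sj)) h)))
        (ℕ.+-monoʳ-≤ (P i j) (ℕ.m≤m+n _ _))
      pointwise i j (yes Si) (yes Sj) = ℕ.≤-trans
        (≤+1* (P i j) (⟦⟧≡1 (S? j) Sj) ℕ.≤-refl)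
        (ℕ.+-monoʳ-≤ (P i j) (ℕ.m≤n+m _ _))

  -- The roles are D = N^δ, E = N^(2-δ), q = ⌊N/K⌋ and n = ⌊2rK⌋.
  module _ {T N #S q n K D E s r η : Carrier}
           (0≤N : 0# ≤ N) (0≤#S : 0# ≤ #S) (0≤q : 0# ≤ q) (0≤n : 0# ≤ n)
           (0≤K : 0# ≤ K) (0<D : 0# < D) (0<E : 0# < E) (0≤s : 0# ≤ s) (0≤η : 0# ≤ η) (η≤1 : η ≤ 1#)
           (ED≈N² : E * D ≈ N * N) (rD≈s : r * D ≈ s)
           (n≤w : n ≤ (r + r) * K) (w≤1+n : (r + r) * K ≤ 1# + n)
           (qK≤N : q * K ≤ N) (N≤[1+q]K : N ≤ (1# + q) * K)
           (D≤ηK : D ≤ η * K) (K≤ηN : K ≤ η * N) (#S≤ηN : #S ≤ η * N) where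

    private
      open ≤-R
      U = (1# + q) * (1# + n)
      -- Dictated by the lower estimate, where the coefficients of `η` and `η²` add up to
      -- `(2s + 1) + 4s + 2(2 + 2s)` and `η² ≤ η`. The upper estimate would get by with `6s + 4`.
      C = fromℕ 10 * s + fromℕ 5
      0≤1-η = ≤⇒0≤- η≤1
      0≤D = <⇒≤ 0<D
      wD≈2sK : (r + r) * K * D ≈ (s + s) * K
      wD≈2sK = trans (solve 3 (λ r K D → (r :+ r) :* K :* D := (r :* D :+ r :* D) :* K) refl r K D)
        (*-congʳ (+-cong rD≈s rD≈s))
      D≤ηN : D ≤ η * N
      D≤ηN = begin
        D        ≤⟨ D≤ηK ⟩
        η * K    ≤⟨ *-monoʳ-≤ 0≤K η≤1 ⟩
        1# * K   ≈⟨ *-identityˡ K ⟩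
        K        ≤⟨ K≤ηN ⟩
        η * N    ∎
      qD≤ηN : q * D ≤ η * N
      qD≤ηN = begin
        q * D          ≤⟨ *-monoˡ-≤ 0≤q D≤ηK ⟩
        q * (η * K)    ≈⟨ solve 3 (λ q η K → q :* (η :* K) := η :* (q :* K)) refl q η K ⟩
        η * (q * K)    ≤⟨ *-monoˡ-≤ 0≤η qK≤N ⟩
        η * N          ∎
      -- The main term is `2s q K ≤ 2s N`. The extra block costs `2s K + D` and the extra hit per
      -- block costs `q D`, where each of `K`, `D` and `q D` is at most `η N`.
      UD≤ : U * D ≤ N * (s + s + (1# + 1# + s + s) * η)
      UD≤ = begin
        U * D
          ≤⟨ ≤-by ((0≤1 ⊕ 0≤q) ⊗ ≤⇒0≤- n≤w ⊗ 0≤D)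
               (solve 4 (λ q n w D → (:1 :+ q) :* (:1 :+ w) :* D :- (:1 :+ q) :* (:1 :+ n) :* D :=
                   (:1 :+ q) :* (w :- n) :* D)
                 refl q n ((r + r) * K) D) ⟩
        (1# + q) * (1# + (r + r) * K) * D
          ≈⟨ trans (solve 3 (λ q w D → (:1 :+ q) :* (:1 :+ w) :* D := (:1 :+ q) :* (D :+ w :* D)) refl q
              ((r + r) * K) D)
               (*-congˡ (+-congˡ wD≈2sK)) ⟩
        (1# + q) * (D + (s + s) * K)
          ≤⟨ ≤-by ((0≤s ⊕ 0≤s) ⊗ ≤⇒0≤- qK≤N ⊕ (0≤s ⊕ 0≤s) ⊗ ≤⇒0≤- K≤ηN ⊕ ≤⇒0≤- qD≤ηN ⊕ ≤⇒0≤- D≤ηN)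
               (solve 6 (λ N s q K D η → N :* (s :+ s :+ (:1 :+ :1 :+ s :+ s) :* η) :- (:1 :+ q) :*
                   (D :+ (s :+ s) :* K)
                  := (s :+ s) :* (N :- q :* K) :+ (s :+ s) :* (η :* N :- K) :+ (η :* N :- q :* D) :+
                      (η :* N :- D)) refl N s q K D η) ⟩
        N * (s + s + (1# + 1# + s + s) * η) ∎
      LD≥ : N * (s + s - (s + s + 1#) * η) ≤ q * n * D
      LD≥ = begin
        N * (s + s - (s + s + 1#) * η)
          ≤⟨ ≤-by ((0≤s ⊕ 0≤s) ⊗ ≤⇒0≤- N≤[1+q]K ⊕ (0≤s ⊕ 0≤s) ⊗ ≤⇒0≤- K≤ηN ⊕ ≤⇒0≤- qD≤ηN)
               (solve 6 (λ N s q K D η → q :* ((s :+ s) :* K :- D) :- N :* (s :+ s :- (s :+ s :+ :1) :* η)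
                  := (s :+ s) :* ((:1 :+ q) :* K :- N) :+ (s :+ s) :* (η :* N :- K) :+
                      (η :* N :- q :* D)) refl N s q K D η) ⟩
        q * ((s + s) * K - D)
          ≈⟨ *-congˡ (+-congʳ wD≈2sK) ⟨
        q * ((r + r) * K * D - D)
          ≤⟨ ≤-by (0≤q ⊗ ≤⇒0≤- w≤1+n ⊗ 0≤D)
               (solve 4 (λ q n w D → q :* n :* D :- q :* (w :* D :- D) := q :* (:1 :+ n :- w) :* D)
                   refl q n ((r + r) * K) D) ⟩
        q * n * D ∎
      /E : ∀ x → x * E / E ≈ x
      /E x = trans (*-assoc x E (E ⁻¹)) (trans (*-congˡ (⁻¹-inverseʳ⁺ 0<E)) (*-identityʳ x))

    -- Since `E D ≈ N²`, comparing `T / E` with `2s` means comparing `T D` with `2s N²`, where only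
    -- `D` meets the hit counts and `E` disappears.
    ratio-upper : T ≤ N * U + #S * U → T / E - (s + s) ≤ C * η
    ratio-upper T≤ = begin
      T / E - (s + s)                      ≤⟨ +-monoˡ-≤ _
          (*-monoʳ-≤ (⁻¹-nonneg 0<E) (*-cancelʳ-≤ 0<D TD≤)) ⟩
      (s + s + C * η) * E / E - (s + s)    ≈⟨ +-congʳ (/E _) ⟩
      s + s + C * η - (s + s)              ≈⟨ solve 2 (λ a b → a :+ b :- a := b) refl (s + s) (C * η) ⟩
      C * η                                ∎
      where
      0≤UD = ((0≤1 ⊕ 0≤q) ⊗ (0≤1 ⊕ 0≤n)) ⊗ 0≤D
      TD≤ : T * D ≤ (s + s + C * η) * E * D
      TD≤ = begin
        T * D
          ≤⟨ *-monoʳ-≤ 0≤D T≤ ⟩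
        (N * U + #S * U) * D
          ≈⟨ solve 4 (λ N S U D → (N :* U :+ S :* U) :* D := (N :+ S) :* (U :* D)) refl N #S U D ⟩
        (N + #S) * (U * D)
          ≤⟨ *-mono-≤ 0≤UD (0≤N ⊕ 0≤η ⊗ 0≤N) (+-mono-≤ ≤-refl #S≤ηN) UD≤ ⟩
        (N + η * N) * (N * (s + s + (1# + 1# + s + s) * η))
          ≤⟨ ≤-by (0≤N ⊗ 0≤N ⊗ (((0≤1 ⊕ 0≤1 ⊕ 0≤s ⊕ 0≤s) ⊗ 0≤η ⊗ 0≤1-η) ⊕
              (0≤s ⊕ 0≤s ⊕ 0≤s ⊕ 0≤s ⊕ 0≤1) ⊗ 0≤η))
               (solve 3 (λ N s η → (s :+ s :+ (con (+ 10) :* s :+ con (+ 5)) :* η) :* (N :* N)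
                   :- (N :+ η :* N) :* (N :* (s :+ s :+ (:1 :+ :1 :+ s :+ s) :* η))
                  := N :* N :* ((:1 :+ :1 :+ s :+ s) :* η :* (:1 :- η) :+
                      (s :+ s :+ s :+ s :+ :1) :* η)) refl N s η) ⟩
        (s + s + C * η) * (N * N)
          ≈⟨ trans (*-assoc _ E D) (*-congˡ ED≈N²) ⟨
        (s + s + C * η) * E * D ∎

    ratio-lower : N * (q * n) ≤ T + (#S * U + #S * U) → - (T / E - (s + s)) ≤ C * η
    ratio-lower ≤T = begin
      - (T / E - (s + s))                  ≈⟨ solve 2 (λ t s → :- (t :- s) := s :- t) refl (T / E) (s + s) ⟩
      s + s - T / E                        ≤⟨ +-mono-≤ ≤-refl
          (neg-mono-≤ (*-monoʳ-≤ (⁻¹-nonneg 0<E) (*-cancelʳ-≤ 0<D ≤TD))) ⟩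
      s + s - (s + s - C * η) * E / E      ≈⟨ +-congˡ (-‿cong (/E _)) ⟩
      s + s - (s + s - C * η)              ≈⟨ solve 2 (λ a b → a :- (a :- b) := b) refl (s + s) (C * η) ⟩
      C * η                                ∎
      where
      ≤TD : (s + s - C * η) * E * D ≤ T * D
      ≤TD = begin
        (s + s - C * η) * E * D
          ≈⟨ trans (*-assoc _ E D) (*-congˡ ED≈N²) ⟩
        (s + s - C * η) * (N * N)
          ≤⟨ ≤-by (0≤N ⊗ 0≤N ⊗ ((0≤1 ⊕ 0≤1 ⊕ 0≤s ⊕ 0≤s) ⊗ 0≤η ⊗ 0≤1-η ⊕
              (0≤1 ⊕ 0≤1 ⊕ 0≤s ⊕ 0≤s) ⊗ 0≤η ⊗ 0≤1-η))
               (solve 3 (λ N s η → N :* (N :* (s :+ s :- (s :+ s :+ :1) :* η))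
                     :- (η :* N :+ η :* N) :* (N :* (s :+ s :+ (:1 :+ :1 :+ s :+ s) :* η))
                     :- (s :+ s :- (con (+ 10) :* s :+ con (+ 5)) :* η) :* (N :* N)
                  := N :* N :* ((:1 :+ :1 :+ s :+ s) :* η :* (:1 :- η) :+ (:1 :+ :1 :+ s :+ s) :* η :*
                      (:1 :- η))) refl N s η) ⟩
        N * (N * (s + s - (s + s + 1#) * η)) - (η * N + η * N) * (N * (s + s + (1# + 1# + s + s) * η))
          ≤⟨ +-mono-≤ (*-monoˡ-≤ 0≤N LD≥) (neg-mono-≤ (*-mono-≤ (((0≤1 ⊕ 0≤q) ⊗ (0≤1 ⊕ 0≤n)) ⊗ 0≤D)
               (0≤η ⊗ 0≤N ⊕ 0≤η ⊗ 0≤N) (+-mono-≤ #S≤ηN #S≤ηN) UD≤)) ⟩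
        N * (q * n * D) - (#S + #S) * (U * D)
          ≤⟨ ≤-by (≤⇒0≤- ≤T ⊗ 0≤D)
               (solve 6 (λ N L S U D T → T :* D :- (N :* (L :* D) :- (S :+ S) :* (U :* D))
                  := (T :+ (S :* U :+ S :* U) :- N :* L) :* D) refl N (q * n) #S U D T) ⟩
        T * D ∎

    ratio-bounds : T ≤ N * U + #S * U → N * (q * n) ≤ T + (#S * U + #S * U) →
      T / E - (s + s) ≤ C * η × - (T / E - (s + s)) ≤ C * η
    ratio-bounds T≤ ≤T = ratio-upper T≤ , ratio-lower ≤T

  -- The sequence

  -- Block lengths are restricted to powers of 2, so the desired size can be met only up to a factor
  -- of 2.
  power-of-2-between : ∀ {x} → 1# ≤ x → ∃[ k ] (x ≤ fromℕ (2 ℕ.^ k) × fromℕ (2 ℕ.^ k) ≤ x + x)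
  power-of-2-between {x} 1≤x = down n (≤-trans x≤n (fromℕ-mono-≤ (ℕ.<⇒≤ (n<2^n n))))
    where
    n = proj₁ (archimedean x)
    x≤n = proj₂ (archimedean x)
    down : ∀ k → x ≤ fromℕ (2 ℕ.^ k) → ∃[ k ] (x ≤ fromℕ (2 ℕ.^ k) × fromℕ (2 ℕ.^ k) ≤ x + x)
    down zero    x≤1 = 0 , x≤1 , ≤-by (1≤⇒0≤ 1≤x ⊕ ≤⇒0≤- 1≤x)
      (solve 1 (λ x → x :+ x :- (:1 :+ con (+ 0)) := x :+ (x :- :1)) refl x)
    down (suc k) x≤2K with x ≤? fromℕ (2 ℕ.^ k)
    ... | yes x≤K = down k x≤K
    ... | no  x≰K = suc k , x≤2K , ≤-respˡ-≈
      (trans (+-congˡ (sym (trans (fromℕ-+ K 0) (+-identityʳ _)))) (sym (fromℕ-+ K (K ℕ.+ 0))))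
      (+-mono-≤ K≤x K≤x)
      where
      K = 2 ℕ.^ k
      K≤x = <⇒≤ (≰⇒> x≰K)

  -- Separation of `γ₁` from the differences of 0 and `γ₂` modulo 1

  module _ {γ₁ γ₂ : Carrier} (0<γ₁ : 0# < γ₁) (γ₁≤½ : γ₁ ≤ 1# / fromℕ 2)
           (0<γ₂ : 0# < γ₂) (γ₂≤½ : γ₂ ≤ 1# / fromℕ 2) (γ₁≉γ₂ : ¬ (γ₁ ≈ γ₂)) where

    private
      twice : ∀ {γ} → γ ≤ 1# / fromℕ 2 → γ + γ ≤ 1#
      twice γ≤½ = ≤-respʳ-≈ (trans (solve 1 (λ h → :1 :* h :+ :1 :* h := :2 :* h) refl (fromℕ 2 ⁻¹))
        (⁻¹-inverseʳ⁺ (1≤⇒0< (1≤fromℕ 2)))) (+-mono-≤ γ≤½ γ≤½)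
      2γ₁≤1 = twice γ₁≤½
      2γ₂≤1 = twice γ₂≤½
      0≤γ₁ = <⇒≤ 0<γ₁
      0≤γ₂ = <⇒≤ 0<γ₂

      minimum : ∀ {a b} → 0# < a → 0# < b → ∃[ c ] (0# < c × c ≤ a × c ≤ b)
      minimum {a} {b} 0<a 0<b with total a b
      ... | inj₁ a≤b = a , 0<a , ≤-refl , a≤b
      ... | inj₂ b≤a = b , 0<b , b≤a , ≤-refl

      -- gap bounds from below the distances from γ₁ to 0 and ±γ₂ modulo 1.
      gap′ : ∃[ c ] (0# < c × c ≤ γ₁ × (c ≤ γ₂ - γ₁ ⊎ c ≤ γ₁ - γ₂))
      gap′ = [ (λ γ₁≤γ₂ → let c , 0<c , c≤γ₁ , c≤d = minimum 0<γ₁ (<⇒0<- (γ₁≤γ₂ , γ₁≉γ₂))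
                         in c , 0<c , c≤γ₁ , inj₁ c≤d)
             , (λ γ₂≤γ₁ → let c , 0<c , c≤γ₁ , c≤d = minimum 0<γ₁ (<⇒0<- (γ₂≤γ₁ , λ e → γ₁≉γ₂ (sym e)))
                         in c , 0<c , c≤γ₁ , inj₂ c≤d) ]′ (total γ₁ γ₂)

    gap : Carrier
    gap = proj₁ gap′

    0<gap : 0# < gap
    0<gap = proj₁ (proj₂ gap′)

    gap≤γ₁ : gap ≤ γ₁
    gap≤γ₁ = proj₁ (proj₂ (proj₂ gap′))

    module _ {r} (r<gap : r < gap) where

      private
        far : ∀ {x y} → y ≈ x ⊎ y ≈ - x → gap ≤ x → gap ≤ 1# - x → ¬ (‖ y ‖ ≤ r)
        far (inj₁ y≈x) gap≤x gap≤1-x h = [ (λ x≤r → <⇒≱ r<gap (≤-trans gap≤x x≤r)) ,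
            (λ p → <⇒≱ r<gap (≤-trans gap≤1-x p)) ]′
          (‖‖≤⇒near-0-or-1 (‖‖≤-cong y≈x h))
        far {x} (inj₂ y≈-x) gap≤x gap≤1-x h = [ (λ x≤r → <⇒≱ r<gap (≤-trans gap≤x x≤r)) ,
            (λ p → <⇒≱ r<gap (≤-trans gap≤1-x p)) ]′
          (‖‖≤⇒near-0-or-1 (‖‖≤-neg (trans (solve 1 (λ x → x := :- :- x) refl x) (-‿cong (sym y≈-x))) h))

      far-0 : ∀ {y} → y ≈ - γ₁ → ¬ (‖ y ‖ ≤ r)
      far-0 y≈ = far (inj₂ y≈) gap≤γ₁
        (≤-trans gap≤γ₁ (≤-by (≤⇒0≤- 2γ₁≤1) (solve 1 (λ g → :1 :- g :- g := :1 :- (g :+ g)) refl γ₁)))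

      far-γ₂ : ¬ (‖ γ₂ - 0# - γ₁ ‖ ≤ r)
      far-γ₂ = [ (λ c → far (inj₁ (solve 2 (λ a b → b :- con (+ 0) :- a := b :- a) refl γ₁ γ₂)) c
                   (≤-trans gap≤γ₁ (≤-by (0≤γ₂ ⊕ ≤⇒0≤- 2γ₂≤1)
                     (solve 2 (λ a b → :1 :- (b :- a) :- a := b :+ (:1 :- (b :+ b))) refl γ₁ γ₂))))
               , (λ c → far (inj₂ (solve 2 (λ a b → b :- con (+ 0) :- a := :- (a :- b)) refl γ₁ γ₂)) c
                   (≤-trans gap≤γ₁ (≤-by (0≤γ₂ ⊕ ≤⇒0≤- 2γ₁≤1)
                     (solve 2 (λ a b → :1 :- (a :- b) :- a := b :+ (:1 :- (a :+ a))) refl γ₁ γ₂)))) ]′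
               (proj₂ (proj₂ (proj₂ gap′)))

      -- The sum `γ₁ + γ₂` is at least `gap` above 0, since it is at least `γ₁`. It also stays at
      -- least `gap` below 1: the larger number is at most 1/2, so `1 - (γ₁ + γ₂)` is at least the
      -- distance between the two.
      far-neg-γ₂ : ¬ (‖ 0# - γ₂ - γ₁ ‖ ≤ r)
      far-neg-γ₂ = far (inj₂ (solve 2 (λ a b → con (+ 0) :- b :- a := :- (a :+ b)) refl γ₁ γ₂))
        (≤-trans gap≤γ₁ (≤-by 0≤γ₂ (solve 2 (λ a b → a :+ b :- a := b) refl γ₁ γ₂)))
        ([ (λ c → ≤-trans c (≤-by (≤⇒0≤- 2γ₂≤1)
            (solve 2 (λ a b → :1 :- (a :+ b) :- (b :- a) := :1 :- (b :+ b)) refl γ₁ γ₂)))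
         , (λ c → ≤-trans c (≤-by (≤⇒0≤- 2γ₁≤1)
             (solve 2 (λ a b → :1 :- (a :+ b) :- (a :- b) := :1 :- (a :+ a)) refl γ₁ γ₂)))
         ]′ (proj₂ (proj₂ (proj₂ gap′))))

    cluster : ℕ → Carrier
    cluster zero    = 0#
    cluster (suc _) = γ₂

    far-cluster : ∀ {r} → r < gap → ∀ a b → ¬ (‖ cluster a - cluster b - γ₁ ‖ ≤ r)
    far-cluster r<gap zero    zero    = far-0 r<gap
        (solve 1 (λ g → con (+ 0) :- con (+ 0) :- g := :- g) refl γ₁)
    far-cluster r<gap zero    (suc _) = far-neg-γ₂ r<gap
    far-cluster r<gap (suc _) zero    = far-γ₂ r<gap
    far-cluster r<gap (suc _) (suc _) = far-0 r<gap (solve 2 (λ g h → h :- h :- g := :- g) refl γ₁ γ₂)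

    -- The modified van der Corput sequence

    module _ {δ : Carrier} (0<δ : 0# < δ) (δ<1 : δ < 1#) where

      private
        0≤δ = <⇒≤ 0<δ
        δ≤1 = <⇒≤ δ<1
        q₀ = proj₁ (reciprocal-≤ 0<δ)
        -- As `(q₀ + 1) δ ≥ 1`, at `N = 2^(ep)` this gives `N^δ ≥ 2^(3e)`. The 3 has to beat the
        -- exponent 2 in the factor `2^(2e+2)` that sparsity costs when pairs are counted.
        p = 3 ℕ.* suc q₀

        select : ∀ {P : Set} → Dec P → Carrier → Carrier → Carrier
        select (yes _) a b = a
        select (no  _) a b = b

        select-yes : ∀ {P : Set} (P? : Dec P) {a b} → P → select P? a b ≡ a
        select-yes (yes _)  _ = ≡.refl
        select-yes (no ¬P)  P = contradiction P ¬P

        select-no : ∀ {P : Set} (P? : Dec P) {a b} → ¬ P → select P? a b ≡ b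
        select-no (yes P)  ¬P = contradiction P ¬P
        select-no (no _)   _  = ≡.refl

      z : ℕ → Carrier
      z i = select (sparse? p i) (cluster (i ℕ.% 2)) (corput i)

      z-sparse : ∀ {i} → Sparse p i → z i ≡ cluster (i ℕ.% 2)
      z-sparse {i} = select-yes (sparse? p i)

      z-corput : ∀ {i} → ¬ Sparse p i → z i ≈ corput i
      z-corput {i} ¬Si = reflexive (select-no (sparse? p i) ¬Si)

      y : ℕ → Carrier
      y = fromIndex1 z

      -- Weak pair correlation at `γ₁`

      weak-γ₁ : WeakPPC δ γ₁ y
      weak-γ₁ s 0<s ε 0<ε = N₀ , λ N N₀≤N → ≤-<-trans
        (∣∣≤ (proj₁ (estimate N N₀≤N)) (proj₂ (estimate N N₀≤N))) Cη<ε
        where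
        open ≤-R
        C = fromℕ 10 * s + fromℕ 5
        m₁ = proj₁ (archimedean-multiple C 0<ε)
        m₂ = proj₁ (archimedean-multiple s 0<gap)
        -- Large enough for two purposes: the final error `C / M` is below `ε`, and `s / N^δ` is
        -- below `gap` as soon as `N^δ ≥ M`.
        M = suc m₁ ℕ.+ suc m₂
        ℕM = fromℕ M
        0<M : 0# < ℕM
        0<M = 1≤⇒0< (1≤fromℕ M)
        η = ℕM ⁻¹
        Mη : ℕM * η ≈ 1#
        Mη = ⁻¹-inverseʳ⁺ 0<M
        0≤η = ⁻¹-nonneg 0<M
        η≤1 = ⁻¹≤1 (1≤fromℕ M)
        C<Mε : C < ℕM * ε
        C<Mε = <-≤-trans (proj₂ (archimedean-multiple C 0<ε))
            (*-monoʳ-≤ (<⇒≤ 0<ε) (fromℕ-mono-≤ (ℕ.m≤m+n (suc m₁) (suc m₂))))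
        s<Mgap : s < ℕM * gap
        s<Mgap = <-≤-trans (proj₂ (archimedean-multiple s 0<gap))
            (*-monoʳ-≤ (<⇒≤ 0<gap) (fromℕ-mono-≤ (ℕ.m≤n+m (suc m₂) (suc m₁))))
        Cη<ε : C * η < ε
        Cη<ε = begin-strict
          C * η          <⟨ *-monoʳ-< (⁻¹-pos 0<M) C<Mε ⟩
          ℕM * ε * η     ≈⟨ solve 3 (λ m e h → m :* e :* h := (m :* h) :* e) refl ℕM ε η ⟩
          ℕM * η * ε     ≈⟨ trans (*-congʳ Mη) (*-identityˡ ε) ⟩
          ε              ∎
        ≤η* : ∀ {a b} → ℕM * a ≤ b → a ≤ η * b
        ≤η* {a} {b} Ma≤b = begin
          a              ≈⟨ trans (*-congʳ Mη) (*-identityˡ a) ⟨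
          ℕM * η * a     ≈⟨ solve 3 (λ m e h → m :* e :* h := e :* (m :* h)) refl ℕM η a ⟩
          η * (ℕM * a)   ≤⟨ *-monoˡ-≤ 0≤η Ma≤b ⟩
          η * b          ∎

        large₁ = #sparse-sublinear p M
        -- The block length `K` will be a power of 2 between `M N^δ` and `2M N^δ`. The lower end
        -- gives `N^δ ≤ η K`, and `2M² N^δ ≤ N` turns the upper end into `K ≤ η N`.
        large₂ = ^ʳ-sublinear δ<1 (M ℕ.* (M ℕ.+ M))
        large₃ = ^ʳ-unbounded 0<δ M
        N₀ = proj₁ large₁ ℕ.+ (proj₁ large₂ ℕ.+ proj₁ large₃)

        estimate : ∀ N .{{_ : NonZero N}} → N₀ ℕ.≤ N →
          let ratio = fromℕ (pairCount y γ₁ (s / N ^ʳ δ) N) / N ^ʳ (2# - δ) in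
          ratio - 2# * s ≤ C * η × - (ratio - 2# * s) ≤ C * η
        estimate N N₀≤N =
          ≤-respˡ-≈ (+-congˡ (-‿cong 2s)) (proj₁ bounds) ,
          ≤-respˡ-≈ (-‿cong (+-congˡ (-‿cong 2s))) (proj₂ bounds)
          where
          2s : s + s ≈ 2# * s
          2s = solve 1 (λ s → s :+ s := :2 :* s) refl s
          D = N ^ʳ δ
          E = N ^ʳ (2# - δ)
          r = s / D
          T = pairCount y γ₁ r N
          1≤D : 1# ≤ D
          1≤D = 1≤^ʳ 0≤δ N
          0<D = 1≤⇒0< 1≤D
          0<E : 0# < E
          0<E = 1≤⇒0< (1≤^ʳ (≤-by (≤⇒0≤- δ≤1 ⊕ 0≤1)
              (solve 1 (λ d → :2 :- d :- con (+ 0) := :1 :- d :+ :1) refl δ)) N)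
          0≤r : 0# ≤ r
          0≤r = <⇒≤ 0<s ⊗ ⁻¹-nonneg 0<D
          rD≈s : r * D ≈ s
          rD≈s = trans (*-assoc s (D ⁻¹) D)
              (trans (*-congˡ (trans (*-comm _ _) (⁻¹-inverseʳ⁺ 0<D))) (*-identityʳ s))
          M#≤N : M ℕ.* #sparse p N ℕ.≤ N
          M#≤N = proj₂ large₁ N (ℕ.≤-trans (ℕ.m≤m+n _ _) N₀≤N)
          2M²D≤N : fromℕ (M ℕ.* (M ℕ.+ M)) * D ≤ fromℕ N
          2M²D≤N = proj₂ large₂ N (ℕ.≤-trans (ℕ.≤-trans (ℕ.m≤m+n _ _) (ℕ.m≤n+m _ (proj₁ large₁))) N₀≤N)
          M≤D : ℕM ≤ D
          M≤D = proj₂ large₃ N (ℕ.≤-trans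
              (ℕ.≤-trans (ℕ.m≤n+m _ (proj₁ large₂)) (ℕ.m≤n+m _ (proj₁ large₁))) N₀≤N)
          r<gap : r < gap
          r<gap = *-cancelʳ-< (<⇒≤ 0<D) (begin-strict
            r * D      ≈⟨ rD≈s ⟩
            s          <⟨ s<Mgap ⟩
            ℕM * gap   ≤⟨ *-monoʳ-≤ (<⇒≤ 0<gap) M≤D ⟩
            D * gap    ≈⟨ *-comm D gap ⟩
            gap * D    ∎)
          2r<1 : r + r < 1#
          2r<1 = 0<-⇒< (<-≤-trans (<⇒0<- r<gap) (≤-by (0≤r⇒ ⊕ ≤⇒0≤- gap≤γ₁ ⊕ ≤⇒0≤- gap≤γ₁ ⊕ ≤⇒0≤- 2γ₁≤1)
            (solve 3 (λ r g a → :1 :- (r :+ r) :- (g :- r) := (g :- r) :+ (a :- g) :+ (a :- g) :+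
                (:1 :- (a :+ a))) refl r gap γ₁)))
            where 0≤r⇒ = ≤⇒0≤- (<⇒≤ r<gap)
          1≤MD : 1# ≤ ℕM * D
          1≤MD = ≤-respˡ-≈ (*-identityˡ 1#) (*-mono-≤ 0≤1 (<⇒≤ 0<M) (1≤fromℕ M) 1≤D)
          k = proj₁ (power-of-2-between 1≤MD)
          K = 2 ℕ.^ k
          MD≤K = proj₁ (proj₂ (power-of-2-between 1≤MD))
          K≤2MD = proj₂ (proj₂ (power-of-2-between 1≤MD))
          MK≤N : ℕM * fromℕ K ≤ fromℕ N
          MK≤N = begin
            ℕM * fromℕ K                 ≤⟨ *-monoˡ-≤ (<⇒≤ 0<M) K≤2MD ⟩
            ℕM * (ℕM * D + ℕM * D)       ≈⟨ solve 2
                (λ m d → m :* (m :* d :+ m :* d) := m :* (m :+ m) :* d) refl ℕM D ⟩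
            ℕM * (ℕM + ℕM) * D           ≈⟨ *-congʳ (trans (fromℕ-* M (M ℕ.+ M)) (*-congˡ (fromℕ-+ M M))) ⟨
            fromℕ (M ℕ.* (M ℕ.+ M)) * D  ≤⟨ 2M²D≤N ⟩
            fromℕ N                      ∎
          instance
            K≢0 : NonZero K
            K≢0 = ℕ.m^n≢0 2 k
          q = N ℕ./ K
          qK≤N : q ℕ.* K ℕ.≤ N
          qK≤N = ℕ.≤-trans (ℕ.m≤n+m _ (N ℕ.% K)) (ℕ.≤-reflexive (≡.sym (m≡m%n+[m/n]*n N K)))
          N≤[1+q]K : N ℕ.≤ suc q ℕ.* K
          N≤[1+q]K = ℕ.≤-trans (ℕ.≤-reflexive (m≡m%n+[m/n]*n N K)) (ℕ.+-monoˡ-≤ _ (ℕ.<⇒≤ (m%n<n N K)))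
          ⌊w⌋ = floor ((0≤r ⊕ 0≤r) ⊗ 0≤fromℕ K)
          n = proj₁ ⌊w⌋
          hits-bounds = corput-hits k {r} {n} {q} {N} 0≤r 2r<1 (proj₁ (proj₂ ⌊w⌋))
              (proj₂ (proj₂ ⌊w⌋)) qK≤N N≤[1+q]K
          far-sparse : ∀ {i j} → Sparse p i → Sparse p j → ¬ (‖ z i - z j - γ₁ ‖ ≤ r)
          far-sparse {i} {j} Si Sj h = far-cluster r<gap (i ℕ.% 2) (j ℕ.% 2)
            (‖‖≤-cong (+-congʳ (+-cong (reflexive (z-sparse {i} Si))
                (-‿cong (reflexive (z-sparse {j} Sj))))) h)
          upper : T ℕ.≤ N ℕ.* (suc q ℕ.* suc n) ℕ.+ #sparse p N ℕ.* (suc q ℕ.* suc n)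
          upper = pairCount-upper corput z (sparse? p) z-corput
              (far-0 r<gap refl) far-sparse {N} hits-bounds
          lower : N ℕ.* (q ℕ.* n) ℕ.≤ T ℕ.+
              (#sparse p N ℕ.* (suc q ℕ.* suc n) ℕ.+ #sparse p N ℕ.* (suc q ℕ.* suc n))
          lower = pairCount-lower corput z (sparse? p) z-corput
              (far-0 r<gap refl) far-sparse {N} hits-bounds

          ℕ*ℕ : ∀ a b c → fromℕ (a ℕ.* (b ℕ.* c)) ≈ fromℕ a * (fromℕ b * fromℕ c)
          ℕ*ℕ a b c = trans (fromℕ-* a (b ℕ.* c)) (*-congˡ (fromℕ-* b c))
          qK≤N′ : fromℕ q * fromℕ K ≤ fromℕ N
          qK≤N′ = ≤-respˡ-≈ (fromℕ-* q K) (fromℕ-mono-≤ qK≤N)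
          N≤[1+q]K′ : fromℕ N ≤ fromℕ (suc q) * fromℕ K
          N≤[1+q]K′ = ≤-respʳ-≈ (fromℕ-* (suc q) K) (fromℕ-mono-≤ N≤[1+q]K)
          #≤ηN : fromℕ (#sparse p N) ≤ η * fromℕ N
          #≤ηN = ≤η* (≤-respˡ-≈ (fromℕ-* M (#sparse p N)) (fromℕ-mono-≤ M#≤N))

          bounds : fromℕ T / E - (s + s) ≤ C * η × - (fromℕ T / E - (s + s)) ≤ C * η
          bounds =
            ratio-bounds {T = fromℕ T} {#S = fromℕ (#sparse p N)} {n = fromℕ n}
              (0≤fromℕ N) (0≤fromℕ (#sparse p N)) (0≤fromℕ q) (0≤fromℕ n) (0≤fromℕ K) 0<D 0<E
                  (<⇒≤ 0<s) 0≤η η≤1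
              (^ʳ-complement 0≤δ δ≤1 N) rD≈s (proj₁ (proj₂ ⌊w⌋)) (<⇒≤ (proj₂ (proj₂ ⌊w⌋))) qK≤N′ N≤[1+q]K′
              (≤η* MD≤K) (≤η* MK≤N) #≤ηN
              (≤-respʳ-≈ (trans (fromℕ-+ (N ℕ.* (suc q ℕ.* suc n)) _)
                (+-cong (ℕ*ℕ N (suc q) (suc n)) #*U)) (fromℕ-mono-≤ upper))
              (≤-respˡ-≈ (ℕ*ℕ N q n) (≤-respʳ-≈ (trans (fromℕ-+ T _) (+-congˡ
                (trans (fromℕ-+ (#sparse p N ℕ.* (suc q ℕ.* suc n)) _) (+-cong #*U #*U))))
                    (fromℕ-mono-≤ lower)))
            where #*U = ℕ*ℕ (#sparse p N) (suc q) (suc n)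

      -- Failure of weak pair correlation at `γ₂`

      ¬weak-γ₂ : ¬ WeakPPC δ γ₂ y
      ¬weak-γ₂ weak = ℕ.m+1+n≰m 12 {3} 16≤12
        where
        -- With `s = 1` the limit would be 2, and tolerance 1 bounds the ratio by 3 from
        -- `proj₁ limit` on.
        limit = weak 1# 0<1 1# 0<1
        -- The summand 4 makes `2^e ≥ 16`, against the bound 12 derived below; the other summand
        -- takes `N = 2^(ep)` past the threshold of the limit.
        e = 4 ℕ.+ proj₁ limit
        N = 2 ℕ.^ (e ℕ.* p)
        instance
          N≢0 : NonZero N
          N≢0 = ℕ.m^n≢0 2 (e ℕ.* p)
        e≤ep : e ℕ.* 3 ℕ.≤ e ℕ.* p
        e≤ep = ℕ.*-monoʳ-≤ e (ℕ.m≤m*n 3 (suc q₀))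
        1+e≤ep : suc e ℕ.≤ e ℕ.* p
        1+e≤ep = ℕ.≤-trans (ℕ.+-monoˡ-≤ e {1} {e} (s≤s z≤n))
            (ℕ.≤-trans (ℕ.≤-reflexive (≡.cong (e ℕ.+_) (≡.sym (ℕ.+-identityʳ e))))
          (ℕ.≤-trans (ℕ.≤-reflexive (ℕ.*-comm 2 e)) (ℕ.≤-trans (ℕ.*-monoʳ-≤ e (ℕ.n≤1+n 2)) e≤ep)))
        N₀≤N : proj₁ limit ℕ.≤ N
        N₀≤N = ℕ.≤-trans (ℕ.m≤n+m _ 4) (ℕ.≤-trans (ℕ.n≤1+n e) (ℕ.≤-trans 1+e≤ep (ℕ.<⇒≤ (n<2^n (e ℕ.* p)))))
        G = 2 ℕ.^ suc e
        Q = 2 ℕ.^ (e ℕ.* p ℕ.∸ suc e)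
        QG≡N : Q ℕ.* G ≡ N
        QG≡N = ≡.trans (≡.sym (ℕ.^-distribˡ-+-* 2 (e ℕ.* p ℕ.∸ suc e) (suc e)))
            (≡.cong (2 ℕ.^_) (ℕ.m∸n+n≡m 1+e≤ep))
        D = N ^ʳ δ
        E = N ^ʳ (2# - δ)
        r = 1# / D
        T = pairCount y γ₂ r N
        0<D : 0# < D
        0<D = 1≤⇒0< (1≤^ʳ 0≤δ N)
        0<E : 0# < E
        0<E = 1≤⇒0< (1≤^ʳ (≤-by (≤⇒0≤- δ≤1 ⊕ 0≤1)
            (solve 1 (λ d → :2 :- d :- con (+ 0) := :1 :- d :+ :1) refl δ)) N)
        0≤r : 0# ≤ r
        0≤r = 0≤1 ⊗ ⁻¹-nonneg 0<D

        even odd : ∀ i → Dec (Sparse p i × i ℕ.% 2 ≡ _)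
        even i = sparse? p i ×-dec (i ℕ.% 2 ℕ.≟ 0)
        odd  i = sparse? p i ×-dec (i ℕ.% 2 ℕ.≟ 1)

        odd-even-close : ∀ i j → (d : Dec (Sparse p i × i ℕ.% 2 ≡ 1))
            (d′ : Dec (Sparse p j × j ℕ.% 2 ≡ 0)) →
          ⟦ d ⟧ ℕ.* ⟦ d′ ⟧ ℕ.≤ close z γ₂ r i j
        odd-even-close i j (no _) _ = z≤n
        odd-even-close i j (yes _) (no _) = z≤n
        odd-even-close i j (yes (Si , i%2≡1)) (yes (Sj , j%2≡0)) = ℕ.≤-reflexive (≡.sym
          (⟦⟧≡1 (closePair? y γ₂ r (suc i , suc j)) (i≢j , ‖‖≤-cong zi-zj (≤ᶻ⇒‖‖≤ (+ 0 ,
            ≤-respˡ-≈ (solve 0 (con (+ 0) := con (+ 0) :- con (+ 0)) refl) 0≤r ,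
            ≤-respˡ-≈ (solve 0 (con (+ 0) := con (+ 0) :- con (+ 0)) refl) 0≤r)))))
          where
          i≢j : ¬ (suc i ≡ suc j)
          i≢j 1+i≡1+j = contradiction
              (≡.trans (≡.sym i%2≡1) (≡.trans (≡.cong (ℕ._% 2) (ℕ.suc-injective 1+i≡1+j)) j%2≡0)) λ()
          zi : z i ≡ γ₂
          zi = ≡.trans (z-sparse {i} Si) (≡.cong cluster i%2≡1)
          zj : z j ≡ 0#
          zj = ≡.trans (z-sparse {j} Sj) (≡.cong cluster j%2≡0)
          zi-zj : 0# ≈ z i - z j - γ₂
          zi-zj = trans (solve 1 (λ g → con (+ 0) := g :- con (+ 0) :- g) refl γ₂)
            (sym (+-congʳ (+-cong (reflexive zi) (-‿cong (reflexive zj)))))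

        Q²≤T : Q ℕ.* Q ℕ.≤ T
        Q²≤T = begin
          Q ℕ.* Q
            ≤⟨ ℕ.*-mono-≤ (#sparse-parity p e Q (s≤s (s≤s z≤n)) QG≡N)
                (#sparse-parity p e Q (s≤s z≤n) QG≡N) ⟩
          ∑ N (λ i → ⟦ odd i ⟧) ℕ.* ∑ N (λ j → ⟦ even j ⟧)
            ≡⟨ ∑-*ʳ N _ _ ⟨
          ∑ N (λ i → ⟦ odd i ⟧ ℕ.* ∑ N (λ j → ⟦ even j ⟧))
            ≡⟨ ∑-cong N (λ i → ∑-*ˡ N _ ⟦ odd i ⟧) ⟨
          ∑ N (λ i → ∑ N (λ j → ⟦ odd i ⟧ ℕ.* ⟦ even j ⟧))
            ≤⟨ ∑-mono N (λ {i} _ → ∑-mono N (λ {j} _ → odd-even-close i j (odd i) (even j))) ⟩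
          ∑ N (λ i → ∑ N (close z γ₂ r i))
            ≡⟨ pairCount≡∑ z γ₂ r N ⟨
          T ∎
          where open ℕ.≤-Reasoning

        open ≤-R

        -- Since `p = 3 (q₀ + 1)`, the number `2^(3e)` is exactly the root of `N` of order `q₀ + 1`,
        -- and `1/(q₀ + 1) ≤ δ`.
        2^3e≤D : fromℕ (2 ℕ.^ (3 ℕ.* e)) ≤ D
        2^3e≤D = ≤-rpow (1≤fromℕ N) 1 q₀ (≤-respˡ-≈ (sym (+-identityʳ 1#)) (proj₂ (reciprocal-≤ 0<δ)))
            (0≤fromℕ (2 ℕ.^ (3 ℕ.* e)))
          (begin-equality
            fromℕ (2 ℕ.^ (3 ℕ.* e)) ^ suc q₀       ≈⟨ fromℕ-^ (2 ℕ.^ (3 ℕ.* e)) (suc q₀) ⟨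
            fromℕ ((2 ℕ.^ (3 ℕ.* e)) ℕ.^ suc q₀)   ≡⟨ ≡.cong fromℕ
                (≡.trans (ℕ.^-*-assoc 2 (3 ℕ.* e) (suc q₀))
                                                         (≡.cong (2 ℕ.^_) exponent)) ⟩
            fromℕ N                                ≈⟨ *-identityʳ _ ⟨
            fromℕ N ^ 1                            ∎)
          where
          exponent : 3 ℕ.* e ℕ.* suc q₀ ≡ e ℕ.* p
          exponent = ≡.trans (≡.cong (ℕ._* suc q₀) (ℕ.*-comm 3 e)) (ℕ.*-assoc e 3 (suc q₀))

        T/E≤3 : fromℕ T / E ≤ fromℕ 3
        T/E≤3 = ≤-by (≤⇒0≤- (≤-trans (x≤∣x∣ (fromℕ T / E - 2# * 1#)) (<⇒≤ (proj₂ limit N N₀≤N))))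
          (solve 1 (λ t → con (+ 3) :- t := :1 :- (t :- :2 :* :1)) refl (fromℕ T / E))

        TD≤3N² : fromℕ T * D ≤ fromℕ 3 * (fromℕ N * fromℕ N)
        TD≤3N² = begin
          fromℕ T * D                    ≈⟨ *-congʳ (trans (*-congˡ (⁻¹-inverseʳ⁺ 0<E)) (*-identityʳ _)) ⟨
          fromℕ T * (E * E ⁻¹) * D       ≈⟨ solve 4
              (λ t e e⁻ d → t :* (e :* e⁻) :* d := (t :* e⁻) :* (e :* d)) refl (fromℕ T) E (E ⁻¹) D ⟩
          fromℕ T / E * (E * D)          ≤⟨ *-monoʳ-≤ (<⇒≤ 0<E ⊗ <⇒≤ 0<D) T/E≤3 ⟩
          fromℕ 3 * (E * D)              ≈⟨ *-congˡ (^ʳ-complement 0≤δ δ≤1 N) ⟩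
          fromℕ 3 * (fromℕ N * fromℕ N)  ∎

        Q²2^3e≤3N² : Q ℕ.* Q ℕ.* 2 ℕ.^ (3 ℕ.* e) ℕ.≤ 3 ℕ.* (N ℕ.* N)
        Q²2^3e≤3N² = fromℕ-cancel-≤ {Q ℕ.* Q ℕ.* 2 ℕ.^ (3 ℕ.* e)} {3 ℕ.* (N ℕ.* N)} (begin
          fromℕ (Q ℕ.* Q ℕ.* 2 ℕ.^ (3 ℕ.* e))           ≈⟨ fromℕ-* (Q ℕ.* Q) (2 ℕ.^ (3 ℕ.* e)) ⟩
          fromℕ (Q ℕ.* Q) * fromℕ (2 ℕ.^ (3 ℕ.* e))     ≤⟨ *-mono-≤ (0≤fromℕ (2 ℕ.^ (3 ℕ.* e)))
              (0≤fromℕ T) (fromℕ-mono-≤ Q²≤T) 2^3e≤D ⟩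
          fromℕ T * D                                   ≤⟨ TD≤3N² ⟩
          fromℕ 3 * (fromℕ N * fromℕ N)                 ≈⟨ trans (fromℕ-* 3 (N ℕ.* N))
              (*-congˡ (fromℕ-* N N)) ⟨
          fromℕ (3 ℕ.* (N ℕ.* N))                       ∎)

        2^e = 2 ℕ.^ e

        -- Q² 2^(3e) ≤ 3 N² = 3 (Q 2^(e+1))², divided by Q² 2^(2e).
        2^e≤12 : 2^e ℕ.≤ 12
        2^e≤12 = ℕ.*-cancelˡ-≤ (Q ℕ.* Q ℕ.* (2^e ℕ.* 2^e)) {{nonZero}}
            (ℕ.≤-trans (ℕ.≤-reflexive left) (ℕ.≤-trans Q²2^3e≤3N² (ℕ.≤-reflexive right)))
          where
          open +-*-Solver renaming (solve to solveℕ; _:*_ to _⊛_; _:=_ to _⊜_; con to conℕ)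
          nonZero : NonZero (Q ℕ.* Q ℕ.* (2^e ℕ.* 2^e))
          nonZero = ℕ.m*n≢0 _ _ {{ℕ.m*n≢0 Q Q {{Q≢0}} {{Q≢0}}}} {{ℕ.m*n≢0 2^e 2^e {{ℕ.m^n≢0 2 e}} {{ℕ.m^n≢0 2 e}}}}
            where Q≢0 = ℕ.m^n≢0 2 (e ℕ.* p ℕ.∸ suc e)
          2^3e : 2 ℕ.^ (3 ℕ.* e) ≡ 2^e ℕ.* 2^e ℕ.* 2^e
          2^3e = ≡.trans (≡.cong (2 ℕ.^_) (ℕ.*-comm 3 e)) (≡.trans (≡.sym (ℕ.^-*-assoc 2 e 3))
            (solveℕ 1 (λ x → x ⊛ (x ⊛ (x ⊛ conℕ 1)) ⊜ x ⊛ x ⊛ x) ≡.refl 2^e))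
          left : Q ℕ.* Q ℕ.* (2^e ℕ.* 2^e) ℕ.* 2^e ≡ Q ℕ.* Q ℕ.* 2 ℕ.^ (3 ℕ.* e)
          left = ≡.trans (ℕ.*-assoc (Q ℕ.* Q) (2^e ℕ.* 2^e) 2^e) (≡.cong (Q ℕ.* Q ℕ.*_) (≡.sym 2^3e))
          right : 3 ℕ.* (N ℕ.* N) ≡ Q ℕ.* Q ℕ.* (2^e ℕ.* 2^e) ℕ.* 12
          right = ≡.trans (≡.cong (λ n → 3 ℕ.* (n ℕ.* n)) (≡.sym QG≡N))
            (solveℕ 2 (λ q x → conℕ 3 ⊛ ((q ⊛ (conℕ 2 ⊛ x)) ⊛ (q ⊛ (conℕ 2 ⊛ x))) ⊜ q ⊛ q ⊛
                (x ⊛ x) ⊛ conℕ 12) ≡.refl Q 2^e)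

        16≤12 : 16 ℕ.≤ 12
        16≤12 = ℕ.≤-trans (ℕ.^-monoʳ-≤ 2 (ℕ.m≤m+n 4 (proj₁ limit))) 2^e≤12

theorem1p3 : (R : CompleteOrderedField) → let open RealAnalysis R in
    ∀ (γ₁ γ₂ δ : Carrier) →
    0# < γ₁ → γ₁ ≤ 1# / fromℕ 2 →
    0# < γ₂ → γ₂ ≤ 1# / fromℕ 2 →
    ¬ (γ₁ ≈ γ₂) →
    0# < δ → δ < 1# →
    Σ[ y ∈ (ℕ → Carrier) ] (WeakPPC δ γ₁ y × ¬ WeakPPC δ γ₂ y)
theorem1p3 R γ₁ γ₂ δ 0<γ₁ γ₁≤½ 0<γ₂ γ₂≤½ γ₁≉γ₂ 0<δ δ<1 =
  y 0<γ₁ γ₁≤½ 0<γ₂ γ₂≤½ γ₁≉γ₂ 0<δ δ<1 ,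
  weak-γ₁ 0<γ₁ γ₁≤½ 0<γ₂ γ₂≤½ γ₁≉γ₂ 0<δ δ<1 ,
  ¬weak-γ₂ 0<γ₁ γ₁≤½ 0<γ₂ γ₂≤½ γ₁≉γ₂ 0<δ δ<1
  where open WeakPairCorrelation R
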